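{- Let $r\ge1$, $k=2r$, let $\ell\le n/2$, and let $C\subseteq[n]$ with $|C|=k$. Let $L_C$ be the Laplacian of the level-$\ell$ Kikuchi graph $K_C$ of the single hyperedge $C$. Then for every $0\le i\le\ell$, $$L_C E_i\;\subseteq\;\bigoplus_{j=\max(0,i-k)}^{\min(\ell,i+k)}E_j .$$
   Context: $[n]=\{1,\dots,n\}$, and $\binom{[n]}{\ell}$ is the family of $\ell$-element subsets of $[n]$. The level-$\ell$ Kikuchi graph $K_C$ of a single hyperedge $C$ is the graph on vertex set $\binom{[n]}{\ell}$ in which $S,T$ are adjacent iff $S\Delta T=C$; its Laplacian is $L_C=D_C-K_C$, where $K_C$ also denotes the adjacency matrix and $D_C$ is the diagonal degree matrix. These matrices act on $V$, the real vector space of all functions $f:\binom{[n]}{\ell}\to\mathbb R$, with the standard inner product $\langle f,g\rangle=\sum_S f(S)g(S)$. For $R\subseteq[n]$ let $p_R\in V$ be $p_R(S)=1$ if $R\subseteq S$ and $p_R(S)=0$ otherwise. For $d\ge0$ let $F_d=\operatorname{span}\{p_R:|R|\le d\}$, and set $F_{ -1}=0$ (one has $F_d=V$ for $d\ge\ell$). For $0\le i\le\ell$ let $E_i=F_i\cap F_{i-1}^{\perp}$. These are the Johnson eigenspaces, and $V=E_0\oplus\cdots\oplus E_\ell$ orthogonally. -}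

module Defs where

open import Level using (Level; Lift; _⊔_) renaming (suc to lsuc)
open import Algebra.Apartness.Bundles using (HeytingField; HeytingCommutativeRing)
open import Algebra.Bundles using (CommutativeRing; RawMonoid)
import Algebra.Definitions.RawMonoid as RawMonoidDefs
open import Data.Bool.Base using (if_then_else_)
open import Data.Fin.Base using (Fin; toℕ)
open import Data.Fin.Subset using (Subset; inside; outside; ∣_∣; _∪_; _─_)
open import Data.Fin.Subset.Properties using (_⊆?_)
open import Data.Integer.Base as ℤ using (ℤ; +_; -[1+_])
open import Data.Irrelevant using ([_])
open import Data.List.Base using (List; []; _∷_; _++_; map; mapMaybe; foldr; filter; length)
open import Data.Maybe.Base using (Maybe; just; nothing)
open import Data.Nat.Base as ℕ using (ℕ; zero; suc)
import Data.Nat.Properties as ℕ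
open import Data.Product.Base using (∃-syntax; _×_; _,_)
open import Data.Product using (∃!)
open import Data.Refinement using (Refinement-syntax; value; _,_)
open import Data.Sum.Base using (_⊎_)
open import Data.Vec.Base using ([]; _∷_)
import Data.Vec.Properties as Vec
import Data.Bool.Properties as Bool
open import Relation.Binary.Core using (Rel)
open import Relation.Binary.Definitions using (Decidable; DecidableEquality)
open import Relation.Binary.PropositionalEquality using (_≡_)
open import Relation.Binary.Structures using (IsStrictPartialOrder)
open import Relation.Nullary.Decidable using (does; yes; no)
open import Relation.Unary using (Pred; _∈_; _∩_)

-- The real numbers, axiomatised as a Cauchy-complete Archimedean ordered
-- field.  Classically such a field is unique up to isomorphism.  The axioms are
-- phrased with a strict order and an apartness relation, without assuming that
-- either is decidable, so that constructive reals are models too.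

record Reals (c ℓ₁ ℓ₂ : Level) : Set (lsuc (c ⊔ ℓ₁ ⊔ ℓ₂)) where
  field
    heytingField : HeytingField c ℓ₁ ℓ₂

  open HeytingField heytingField public

  commutativeRing : CommutativeRing c ℓ₁
  commutativeRing = HeytingCommutativeRing.commutativeRing heytingCommutativeRing

  +-rawMonoid : RawMonoid c ℓ₁
  +-rawMonoid = CommutativeRing.+-rawMonoid commutativeRing

  open RawMonoidDefs +-rawMonoid public using (sum) renaming (_×_ to _·ℕ_)

  infix 4 _<_
  field
    _<_                  : Rel Carrier ℓ₂
    isStrictPartialOrder : IsStrictPartialOrder _≈_ _<_
    <⇒#                  : ∀ {x y} → x < y → x # y
    #⇒<⊎>                : ∀ {x y} → x # y → x < y ⊎ y < x
    +-monoˡ-<            : ∀ {x y} z → x < y → x + z < y + z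
    *-pos                : ∀ {x y} → 0# < x → 0# < y → 0# < x * y
    archimedean          : ∀ x → ∃[ m ] x < m ·ℕ 1#

  -- Since p and q range independently, one-sided bounds express ∣s p − s q∣ < ε.
  Cauchy : (ℕ → Carrier) → Set (c ⊔ ℓ₂)
  Cauchy s = ∀ ε → 0# < ε →
    ∃[ N ] (∀ p q → N ℕ.≤ p → N ℕ.≤ q → s p - s q < ε)

  _⟶_ : (ℕ → Carrier) → Carrier → Set (c ⊔ ℓ₂)
  s ⟶ x = ∀ ε → 0# < ε →
    ∃[ N ] (∀ p → N ℕ.≤ p → s p - x < ε × x - s p < ε)

  field
    complete : ∀ s → Cauchy s → ∃[ x ] s ⟶ x

infixl 6 _△_

_△_ : ∀ {n} → Subset n → Subset n → Subset n
S △ T = (S ─ T) ∪ (T ─ S)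

_≟ˢ_ : ∀ {n} → DecidableEquality (Subset n)
_≟ˢ_ = Vec.≡-dec Bool._≟_

subsets : ∀ n → List (Subset n)
subsets zero    = [] ∷ []
subsets (suc n) = map (outside ∷_) (subsets n) ++ map (inside ∷_) (subsets n)

-- The ℓ-element subsets of an n-element set.  The cardinality proof is
-- irrelevant, so two vertices with the same underlying subset are equal.

Vertex : ℕ → ℕ → Set
Vertex n ℓ = [ S ∈ Subset n ∣ ∣ S ∣ ≡ ℓ ]

vertices : ∀ n ℓ → List (Vertex n ℓ)
vertices n ℓ = mapMaybe toVertex (subsets n)
  where
  toVertex : Subset n → Maybe (Vertex n ℓ)
  toVertex S with ∣ S ∣ ℕ.≟ ℓ
  ... | yes eq = just (S , [ eq ])
  ... | no  _  = nothing

module Johnson {c ℓ₁ ℓ₂ : Level} (ℝ : Reals c ℓ₁ ℓ₂) (n ℓ : ℕ) where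

  open Reals ℝ

  V : Set c
  V = Vertex n ℓ → Carrier

  infix 4 _≋_
  _≋_ : Rel V ℓ₁
  f ≋ g = ∀ S → f S ≈ g S

  0ⱽ : V
  0ⱽ S = 0#

  infixl 6 _+ⱽ_
  _+ⱽ_ : V → V → V
  (f +ⱽ g) S = f S + g S

  infixr 7 _*ⱽ_
  _*ⱽ_ : Carrier → V → V
  (a *ⱽ f) S = a * f S

  ∑ : (Vertex n ℓ → Carrier) → Carrier
  ∑ h = foldr _+_ 0# (map h (vertices n ℓ))

  ⟨_,_⟩ : V → V → Carrier
  ⟨ f , g ⟩ = ∑ λ S → f S * g S

  data Span {a} (P : Pred V a) : Pred V (c ⊔ ℓ₁ ⊔ a) where
    generator : ∀ {f} → f ∈ P → f ∈ Span P
    zeroˢ     : 0ⱽ ∈ Span P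
    addˢ      : ∀ {f g} → f ∈ Span P → g ∈ Span P → f +ⱽ g ∈ Span P
    scaleˢ    : ∀ a {f} → f ∈ Span P → a *ⱽ f ∈ Span P
    respˢ     : ∀ {f g} → f ≋ g → f ∈ Span P → g ∈ Span P

  infix 8 _^⊥
  _^⊥ : ∀ {a} → Pred V a → Pred V (c ⊔ ℓ₁ ⊔ a)
  (W ^⊥) f = ∀ g → g ∈ W → ⟨ f , g ⟩ ≈ 0#

  -- Internal direct sum of the subspaces W lo, …, W hi: the vectors having a
  -- unique decomposition into components from these subspaces.
  ⨁[_⋯_] : ∀ {a} → ℕ → ℕ → (ℕ → Pred V a) → Pred V (c ⊔ ℓ₁ ⊔ a)
  ⨁[ lo ⋯ hi ] W f =
    ∃! {A = Fin (suc hi ℕ.∸ lo) → V} (λ g h → ∀ j → g j ≋ h j) λ g →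
      (∀ j → g j ∈ W (lo ℕ.+ toℕ j)) × f ≋ (λ S → sum λ j → g j S)

  p : Subset n → V
  p R S = if does (R ⊆? value S) then 1# else 0#

  -- Indexed by ℤ for the sake of F₋₁ = 0.
  F : ℤ → Pred V (c ⊔ ℓ₁)
  F (+ d)      = Span λ f → ∃[ R ] (∣ R ∣ ℕ.≤ d × f ≋ p R)
  F (-[1+ _ ]) = λ f → Lift c (f ≋ 0ⱽ)

  E : ℕ → Pred V (c ⊔ ℓ₁)
  E i = F (+ i) ∩ F (ℤ.pred (+ i)) ^⊥

  Matrix : Set c
  Matrix = Vertex n ℓ → Vertex n ℓ → Carrier

  infixr 7 _*ᵛ_
  _*ᵛ_ : Matrix → V → V
  (M *ᵛ f) S = ∑ λ T → M S T * f T

  KikuchiAdjacent : Subset n → Rel (Vertex n ℓ) _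
  KikuchiAdjacent C S T = value S △ value T ≡ C

  kikuchiAdjacent? : ∀ C → Decidable (KikuchiAdjacent C)
  kikuchiAdjacent? C S T = (value S △ value T) ≟ˢ C

  K : Subset n → Matrix
  K C S T = if does (kikuchiAdjacent? C S T) then 1# else 0#

  degree : Subset n → Vertex n ℓ → ℕ
  degree C S = length (filter (kikuchiAdjacent? C S) (vertices n ℓ))

  D : Subset n → Matrix
  D C S T = if does (value S ≟ˢ value T) then degree C S ·ℕ 1# else 0#

  L : Subset n → Matrix
  L C S T = D C S T - K C S T

{-# OPTIONS --safe #-}
-- L_C sends p_R to a function of S ∩ (R ∪ C) alone: S has a neighbour iff
-- 2 ∣S ∩ C∣ = ∣C∣, and then (L_C p_R)(S) = p_R(S) − p_R(S △ C).  Expanding that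
-- function in the p_Q with Q ⊆ R ∪ C gives L_C F_d ⊆ F_{d+k}.  Since L_C is
-- symmetric, it also maps F_{i-1}^⊥ into F_{i-k-1}^⊥, so L_C f lies in
-- F_{i+k} ∩ F_{i-k-1}^⊥, and it remains to split that space into the E_j.
-- Splitting requires orthogonal projections onto the F_d.  Gram–Schmidt needs
-- to decide whether a residue vanishes, which is impossible for constructive
-- reals in general; but the p_R have integer entries, and clearing denominators
-- keeps all residues integral.
module Submission where

open import Defs
open import Algebra.Bundles using (CommutativeRing)
open import Data.Bool.Base using (Bool; true; false; if_then_else_)
open import Data.Fin.Base using (Fin; toℕ; punchIn)
open import Data.Fin.Properties using (punchInᵢ≢i; toℕ-injective)
open import Data.Fin.Subset using (Subset; inside; outside; ∣_∣; _∩_; _∪_; _⊆_)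
open import Data.Fin.Subset.Properties
  using (_⊆?_; ⊆-refl; ⊆-trans; p∩q⊆p; p∩q⊆q; p⊆p∪q; x∈p∩q⁺; p⊆q⇒∣p∣≤∣q∣; drop-∷-⊆;
         ∩-assoc; ∩-comm; ∪-comm; ∩-abs-∪)
open import Data.Integer.Base as ℤ using (+_)
open import Data.Irrelevant using ([_])
open import Data.List.Base using (List; []; _∷_; _++_; map; mapMaybe; foldr; filter; length)
open import Data.List.Membership.Propositional using (find; lose) renaming (_∈_ to _∈ᴸ_)
open import Data.List.Membership.Propositional.Properties
  using (∈-++⁺ˡ; ∈-++⁺ʳ; ∈-map⁺; ∈-filter⁺; ∈-filter⁻)
open import Data.List.Relation.Unary.Any as Any using (Any)
import Data.List.Relation.Unary.Any.Properties as Any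
open import Data.Maybe.Base using (Maybe; just; nothing; maybe′)
open import Data.Nat.Base as ℕ using (ℕ; zero; suc)
import Data.Nat.Properties as ℕ
open import Data.Nat.Solver using (module +-*-Solver)
open import Data.Product.Base using (_×_; _,_; proj₁; proj₂; ∃-syntax)
open import Data.Refinement using (value; _,_)
open import Data.Sum.Base using (_⊎_; inj₁; inj₂)
open import Data.Vec.Base using ([]; _∷_; here)
open import Function.Base using (_∘_; _$_; case_of_)
open import Level using (lift; lower)
open import Relation.Binary.Definitions using (tri<; tri≈; tri>)
open import Relation.Binary.PropositionalEquality as ≡ using (_≡_; _≢_; cong; cong₂; subst)
open import Relation.Binary.Structures using (IsStrictPartialOrder)
open import Relation.Nullary using (Dec; does; yes; no; ¬_; contradiction)
open import Relation.Nullary.Decidable using (dec-true; dec-false)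
open import Relation.Nullary.Negation using (contradiction-irr)
open import Relation.Unary using (Pred; _∈_)

-- Finite subsets: sizes, symmetric differences, restriction to a subset.

does-cong : ∀ {a b} {A : Set a} {B : Set b} (A? : Dec A) (B? : Dec B) →
  (A → B) → (B → A) → does A? ≡ does B?
does-cong (yes a) B? f g = ≡.sym (dec-true B? (f a))
does-cong (no ¬a) B? f g = ≡.sym (dec-false B? (¬a ∘ g))

-- The elements of `S ∩ C` are counted in both `∣ S ∣` and `∣ C ∣` but do not lie in `S △ C`. Hence
-- `S △ C` has the size of `S` exactly when half of `C` lies in `S`, a condition on `S ∩ C` alone.
∣S△C∣+2∣S∩C∣ : ∀ {n} (S C : Subset n) →
  ∣ S △ C ∣ ℕ.+ (∣ S ∩ C ∣ ℕ.+ ∣ S ∩ C ∣) ≡ ∣ S ∣ ℕ.+ ∣ C ∣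
∣S△C∣+2∣S∩C∣ []            []            = ≡.refl
∣S△C∣+2∣S∩C∣ (outside ∷ S) (outside ∷ C) = ∣S△C∣+2∣S∩C∣ S C
∣S△C∣+2∣S∩C∣ (outside ∷ S) (inside  ∷ C) =
  ≡.trans (cong suc (∣S△C∣+2∣S∩C∣ S C)) (≡.sym (ℕ.+-suc ∣ S ∣ ∣ C ∣))
∣S△C∣+2∣S∩C∣ (inside  ∷ S) (outside ∷ C) = cong suc (∣S△C∣+2∣S∩C∣ S C)
∣S△C∣+2∣S∩C∣ (inside  ∷ S) (inside  ∷ C) = begin
  d ℕ.+ (suc m ℕ.+ suc m)         ≡⟨ solve 2 (λ d m → d :+ (con 1 :+ m :+ (con 1 :+ m)) :=
                                       con 2 :+ (d :+ (m :+ m))) ≡.refl d m ⟩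
  2 ℕ.+ (d ℕ.+ (m ℕ.+ m))         ≡⟨ cong (2 ℕ.+_) (∣S△C∣+2∣S∩C∣ S C) ⟩
  2 ℕ.+ (∣ S ∣ ℕ.+ ∣ C ∣)         ≡⟨ cong suc (ℕ.+-suc ∣ S ∣ ∣ C ∣) ⟨
  suc ∣ S ∣ ℕ.+ suc ∣ C ∣         ∎
  where
  open ≡.≡-Reasoning
  open +-*-Solver
  d = ∣ S △ C ∣
  m = ∣ S ∩ C ∣

∣S△C∣≡∣S∣⇒ : ∀ {n} (S C : Subset n) → ∣ S △ C ∣ ≡ ∣ S ∣ → ∣ S ∩ C ∣ ℕ.+ ∣ S ∩ C ∣ ≡ ∣ C ∣
∣S△C∣≡∣S∣⇒ S C eq = ℕ.+-cancelˡ-≡ ∣ S ∣ _ _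
  (≡.trans (cong (ℕ._+ (∣ S ∩ C ∣ ℕ.+ ∣ S ∩ C ∣)) (≡.sym eq)) (∣S△C∣+2∣S∩C∣ S C))

⇒∣S△C∣≡∣S∣ : ∀ {n} (S C : Subset n) → ∣ S ∩ C ∣ ℕ.+ ∣ S ∩ C ∣ ≡ ∣ C ∣ → ∣ S △ C ∣ ≡ ∣ S ∣
⇒∣S△C∣≡∣S∣ S C eq = ℕ.+-cancelʳ-≡ ∣ C ∣ _ _
  (≡.trans (cong (∣ S △ C ∣ ℕ.+_) (≡.sym eq)) (∣S△C∣+2∣S∩C∣ S C))

∣p∪q∣≤∣p∣+∣q∣ : ∀ {n} (p q : Subset n) → ∣ p ∪ q ∣ ℕ.≤ ∣ p ∣ ℕ.+ ∣ q ∣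
∣p∪q∣≤∣p∣+∣q∣ []            []            = ℕ.z≤n
∣p∪q∣≤∣p∣+∣q∣ (outside ∷ p) (outside ∷ q) = ∣p∪q∣≤∣p∣+∣q∣ p q
∣p∪q∣≤∣p∣+∣q∣ (outside ∷ p) (inside  ∷ q) =
  ℕ.≤-trans (ℕ.s≤s (∣p∪q∣≤∣p∣+∣q∣ p q)) (ℕ.≤-reflexive (≡.sym (ℕ.+-suc ∣ p ∣ ∣ q ∣)))
∣p∪q∣≤∣p∣+∣q∣ (inside  ∷ p) (outside ∷ q) = ℕ.s≤s (∣p∪q∣≤∣p∣+∣q∣ p q)
∣p∪q∣≤∣p∣+∣q∣ (inside  ∷ p) (inside  ∷ q) =
  ℕ.s≤s (ℕ.≤-trans (∣p∪q∣≤∣p∣+∣q∣ p q) (ℕ.+-monoʳ-≤ ∣ p ∣ (ℕ.n≤1+n ∣ q ∣)))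

⊆∧∣∣≡⇒≡ : ∀ {n} (S T : Subset n) → S ⊆ T → ∣ S ∣ ≡ ∣ T ∣ → S ≡ T
⊆∧∣∣≡⇒≡ []            []            _   _  = ≡.refl
⊆∧∣∣≡⇒≡ (outside ∷ S) (outside ∷ T) S⊆T eq = cong (outside ∷_) (⊆∧∣∣≡⇒≡ S T (drop-∷-⊆ S⊆T) eq)
⊆∧∣∣≡⇒≡ (outside ∷ S) (inside  ∷ T) S⊆T eq =
  contradiction (ℕ.≤-reflexive (≡.sym eq)) (ℕ.<⇒≱ (ℕ.s≤s (p⊆q⇒∣p∣≤∣q∣ {p = S} {T} (drop-∷-⊆ S⊆T))))
⊆∧∣∣≡⇒≡ (inside  ∷ S) (outside ∷ T) S⊆T eq with () ← S⊆T here
⊆∧∣∣≡⇒≡ (inside  ∷ S) (inside  ∷ T) S⊆T eq =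
  cong (inside ∷_) (⊆∧∣∣≡⇒≡ S T (drop-∷-⊆ S⊆T) (ℕ.suc-injective eq))

△-comm : ∀ {n} (S T : Subset n) → S △ T ≡ T △ S
△-comm S T = ∪-comm _ _

△-cancelˡ : ∀ {n} (S T : Subset n) → S △ (S △ T) ≡ T
△-cancelˡ []            []            = ≡.refl
△-cancelˡ (outside ∷ S) (outside ∷ T) = cong (outside ∷_) (△-cancelˡ S T)
△-cancelˡ (outside ∷ S) (inside  ∷ T) = cong (inside  ∷_) (△-cancelˡ S T)
△-cancelˡ (inside  ∷ S) (outside ∷ T) = cong (outside ∷_) (△-cancelˡ S T)
△-cancelˡ (inside  ∷ S) (inside  ∷ T) = cong (inside  ∷_) (△-cancelˡ S T)

-- For a point of `B`, membership in `S` and in `S ∩ B` agree, and membership in a symmetric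
-- difference is decided pointwise. This is what makes `S △ C`, seen inside `B`, depend on `S ∩ B`
-- only.
△-∩ : ∀ {n} (S C B : Subset n) → (S △ C) ∩ B ≡ ((S ∩ B) △ C) ∩ B
△-∩ []            []            []            = ≡.refl
△-∩ (outside ∷ S) (outside ∷ C) (outside ∷ B) = cong (outside ∷_) (△-∩ S C B)
△-∩ (outside ∷ S) (outside ∷ C) (inside  ∷ B) = cong (outside ∷_) (△-∩ S C B)
△-∩ (outside ∷ S) (inside  ∷ C) (outside ∷ B) = cong (outside ∷_) (△-∩ S C B)
△-∩ (outside ∷ S) (inside  ∷ C) (inside  ∷ B) = cong (inside  ∷_) (△-∩ S C B)
△-∩ (inside  ∷ S) (outside ∷ C) (outside ∷ B) = cong (outside ∷_) (△-∩ S C B)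
△-∩ (inside  ∷ S) (outside ∷ C) (inside  ∷ B) = cong (inside  ∷_) (△-∩ S C B)
△-∩ (inside  ∷ S) (inside  ∷ C) (outside ∷ B) = cong (outside ∷_) (△-∩ S C B)
△-∩ (inside  ∷ S) (inside  ∷ C) (inside  ∷ B) = cong (outside ∷_) (△-∩ S C B)

∩-restrict : ∀ {n} (S R C : Subset n) → (S ∩ (R ∪ C)) ∩ C ≡ S ∩ C
∩-restrict S R C = begin
  (S ∩ (R ∪ C)) ∩ C  ≡⟨ ∩-assoc S (R ∪ C) C ⟩
  S ∩ ((R ∪ C) ∩ C)  ≡⟨ cong (S ∩_) (∩-comm (R ∪ C) C) ⟩
  S ∩ (C ∩ (R ∪ C))  ≡⟨ cong (λ B → S ∩ (C ∩ B)) (∪-comm R C) ⟩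
  S ∩ (C ∩ (C ∪ R))  ≡⟨ cong (S ∩_) (∩-abs-∪ C R) ⟩
  S ∩ C              ∎
  where open ≡.≡-Reasoning

⊆?-∩ : ∀ {n} {R B : Subset n} → R ⊆ B → (S : Subset n) → does (R ⊆? S) ≡ does (R ⊆? (S ∩ B))
⊆?-∩ {R = R} {B} R⊆B S = does-cong (R ⊆? S) (R ⊆? (S ∩ B))
  (λ R⊆S {x} x∈R → x∈p∩q⁺ (R⊆S x∈R , R⊆B x∈R))
  (λ R⊆S∩B {x} x∈R → p∩q⊆p S B (R⊆S∩B x∈R))

⊆?-△ : ∀ {n} {R B : Subset n} → R ⊆ B → (S C : Subset n) →
  does (R ⊆? (S △ C)) ≡ does (R ⊆? ((S ∩ B) △ C))
⊆?-△ {R = R} {B} R⊆B S C = begin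
  does (R ⊆? (S △ C))              ≡⟨ ⊆?-∩ R⊆B (S △ C) ⟩
  does (R ⊆? ((S △ C) ∩ B))        ≡⟨ cong (λ T → does (R ⊆? T)) (△-∩ S C B) ⟩
  does (R ⊆? (((S ∩ B) △ C) ∩ B))  ≡⟨ ⊆?-∩ R⊆B ((S ∩ B) △ C) ⟨
  does (R ⊆? ((S ∩ B) △ C))        ∎
  where open ≡.≡-Reasoning

-- Finite sums in a commutative ring and Möbius expansion over subsets.

module RingSums {c ℓ} (R : CommutativeRing c ℓ) where

  open CommutativeRing R
  open import Algebra.Properties.Ring ring
  open import Relation.Binary.Reasoning.Setoid setoid
  open import Algebra.Solver.Ring.NaturalCoefficients.Default commutativeSemiring
    using (solve; _:+_; _:*_; _:=_)

  sumᴸ : ∀ {a} {A : Set a} → (A → Carrier) → List A → Carrier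
  sumᴸ h xs = foldr _+_ 0# (map h xs)

  𝟙 : Bool → Carrier
  𝟙 b = if b then 1# else 0#

  module _ {a} {A : Set a} where

    sumᴸ-cong : {h h′ : A → Carrier} → (∀ x → h x ≈ h′ x) → ∀ xs → sumᴸ h xs ≈ sumᴸ h′ xs
    sumᴸ-cong eq []       = refl
    sumᴸ-cong eq (x ∷ xs) = +-cong (eq x) (sumᴸ-cong eq xs)

    sumᴸ-zero : {h : A → Carrier} → (∀ x → h x ≈ 0#) → ∀ xs → sumᴸ h xs ≈ 0#
    sumᴸ-zero eq []       = refl
    sumᴸ-zero eq (x ∷ xs) = trans (+-cong (eq x) (sumᴸ-zero eq xs)) (+-identityˡ 0#)

    sumᴸ-+ : (h h′ : A → Carrier) → ∀ xs → sumᴸ (λ x → h x + h′ x) xs ≈ sumᴸ h xs + sumᴸ h′ xs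
    sumᴸ-+ h h′ []       = sym (+-identityˡ 0#)
    sumᴸ-+ h h′ (x ∷ xs) = trans (+-congˡ (sumᴸ-+ h h′ xs))
      (solve 4 (λ a b c d → (a :+ b) :+ (c :+ d) := (a :+ c) :+ (b :+ d)) refl _ _ _ _)

    sumᴸ-*ˡ : ∀ y (h : A → Carrier) xs → sumᴸ (λ x → y * h x) xs ≈ y * sumᴸ h xs
    sumᴸ-*ˡ y h []       = sym (zeroʳ y)
    sumᴸ-*ˡ y h (x ∷ xs) = trans (+-congˡ (sumᴸ-*ˡ y h xs)) (sym (distribˡ y _ _))

    sumᴸ-*ʳ : ∀ y (h : A → Carrier) xs → sumᴸ (λ x → h x * y) xs ≈ sumᴸ h xs * y
    sumᴸ-*ʳ y h xs = trans (sumᴸ-cong (λ x → *-comm (h x) y) xs)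
      (trans (sumᴸ-*ˡ y h xs) (*-comm y _))

    sumᴸ-++ : ∀ (h : A → Carrier) xs ys → sumᴸ h (xs ++ ys) ≈ sumᴸ h xs + sumᴸ h ys
    sumᴸ-++ h []       ys = sym (+-identityˡ _)
    sumᴸ-++ h (x ∷ xs) ys = trans (+-congˡ (sumᴸ-++ h xs ys)) (sym (+-assoc _ _ _))

  sumᴸ-map : ∀ {a b} {A : Set a} {B : Set b} (h : B → Carrier) (t : A → B) xs →
    sumᴸ h (map t xs) ≈ sumᴸ (h ∘ t) xs
  sumᴸ-map h t []       = refl
  sumᴸ-map h t (x ∷ xs) = +-congˡ (sumᴸ-map h t xs)

  sumᴸ-mapMaybe : ∀ {a b} {A : Set a} {B : Set b} (h : B → Carrier) (t : A → Maybe B) xs →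
    sumᴸ h (mapMaybe t xs) ≈ sumᴸ (λ x → maybe′ h 0# (t x)) xs
  sumᴸ-mapMaybe h t []       = refl
  sumᴸ-mapMaybe h t (x ∷ xs) with t x
  ... | just y  = +-congˡ (sumᴸ-mapMaybe h t xs)
  ... | nothing = trans (sumᴸ-mapMaybe h t xs) (sym (+-identityˡ _))

  sumᴸ-swap : ∀ {a b} {A : Set a} {B : Set b} (h : A → B → Carrier) xs ys →
    sumᴸ (λ x → sumᴸ (h x) ys) xs ≈ sumᴸ (λ y → sumᴸ (λ x → h x y) xs) ys
  sumᴸ-swap h []       ys = sym (sumᴸ-zero (λ _ → refl) ys)
  sumᴸ-swap h (x ∷ xs) ys = trans (+-congˡ (sumᴸ-swap h xs ys)) (sym (sumᴸ-+ (h x) _ ys))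

  sumᴸ-subsets-suc : ∀ {n} (H : Subset (suc n) → Carrier) →
    sumᴸ H (subsets (suc n)) ≈
    sumᴸ (H ∘ (outside ∷_)) (subsets n) + sumᴸ (H ∘ (inside ∷_)) (subsets n)
  sumᴸ-subsets-suc {n} H = trans (sumᴸ-++ H (map (outside ∷_) (subsets n)) _)
    (+-cong (sumᴸ-map H _ (subsets n)) (sumᴸ-map H _ (subsets n)))

  -- `subsets` lists every subset exactly once: at each coordinate the half of the list whose head
  -- differs from that of `U` contributes 0.
  sumᴸ-subsets-only : ∀ {n} (H : Subset n → Carrier) U → (∀ S → S ≢ U → H S ≈ 0#) →
    sumᴸ H (subsets n) ≈ H U
  sumᴸ-subsets-only H []                  H≈0 = +-identityʳ _
  sumᴸ-subsets-only {suc n} H (outside ∷ U) H≈0 = begin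
    sumᴸ H (subsets (suc n))
      ≈⟨ sumᴸ-subsets-suc H ⟩
    sumᴸ (H ∘ (outside ∷_)) (subsets n) + sumᴸ (H ∘ (inside ∷_)) (subsets n)
      ≈⟨ +-cong (sumᴸ-subsets-only _ U λ S S≢U → H≈0 _ λ { ≡.refl → S≢U ≡.refl })
                (sumᴸ-zero (λ S → H≈0 _ λ ()) (subsets n)) ⟩
    H (outside ∷ U) + 0#
      ≈⟨ +-identityʳ _ ⟩
    H (outside ∷ U) ∎
  sumᴸ-subsets-only {suc n} H (inside ∷ U) H≈0 = begin
    sumᴸ H (subsets (suc n))
      ≈⟨ sumᴸ-subsets-suc H ⟩
    sumᴸ (H ∘ (outside ∷_)) (subsets n) + sumᴸ (H ∘ (inside ∷_)) (subsets n)
      ≈⟨ +-cong (sumᴸ-zero (λ S → H≈0 _ λ ()) (subsets n))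
                (sumᴸ-subsets-only _ U λ S S≢U → H≈0 _ λ { ≡.refl → S≢U ≡.refl }) ⟩
    0# + H (inside ∷ U)
      ≈⟨ +-identityˡ _ ⟩
    H (inside ∷ U) ∎

  -- The Möbius transform on the Boolean lattice, i.e. the alternating sum of
  -- `(-1)^(∣ R ∣ - ∣ Q ∣) G Q` over `Q ⊆ R`, computed by one difference for each element of `R`.
  möbius : ∀ {n} → (Subset n → Carrier) → Subset n → Carrier
  möbius G []            = G []
  möbius G (outside ∷ R) = möbius (G ∘ (outside ∷_)) R
  möbius G (inside  ∷ R) = möbius (λ S → G (inside ∷ S) - G (outside ∷ S)) R

  -- Induction on coordinates. Where `S` is outside, only those `R` that are outside contribute;
  -- where `S` is inside, both halves do, and they add up to `G₀ + (G₁ - G₀)`, with `G₀` and `G₁`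
  -- the restrictions of `G` to the two values of that coordinate.
  möbius-expansion : ∀ {n} (G : Subset n → Carrier) S →
    G S ≈ sumᴸ (λ R → möbius G R * 𝟙 (does (R ⊆? S))) (subsets n)
  möbius-expansion G [] = sym (trans (+-identityʳ _) (*-identityʳ _))
  möbius-expansion {suc n} G (outside ∷ S) = sym $ begin
    sumᴸ (λ R → möbius G R * 𝟙 (does (R ⊆? (outside ∷ S)))) (subsets (suc n))
      ≈⟨ sumᴸ-subsets-suc (λ R → möbius G R * 𝟙 (does (R ⊆? (outside ∷ S)))) ⟩
    _ + _
      ≈⟨ +-cong (sym (möbius-expansion (G ∘ (outside ∷_)) S)) (sumᴸ-zero (λ R → zeroʳ _) (subsets n)) ⟩
    G (outside ∷ S) + 0#
      ≈⟨ +-identityʳ _ ⟩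
    G (outside ∷ S) ∎
  möbius-expansion {suc n} G (inside ∷ S) = sym $ begin
    sumᴸ (λ R → möbius G R * 𝟙 (does (R ⊆? (inside ∷ S)))) (subsets (suc n))
      ≈⟨ sumᴸ-subsets-suc (λ R → möbius G R * 𝟙 (does (R ⊆? (inside ∷ S)))) ⟩
    _ + _
      ≈⟨ +-cong (möbius-expansion (G ∘ (outside ∷_)) S)
                (möbius-expansion (λ T → G (inside ∷ T) - G (outside ∷ T)) S) ⟨
    G (outside ∷ S) + (G (inside ∷ S) - G (outside ∷ S))
      ≈⟨ +-assoc _ _ _ ⟨
    (G (outside ∷ S) + G (inside ∷ S)) - G (outside ∷ S)
      ≈⟨ xyx⁻¹≈y _ _ ⟩
    G (inside ∷ S) ∎

-- Apartness, sign and integrality of real numbers.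

module RealProperties {c ℓ₁ ℓ₂} (ℝ : Reals c ℓ₁ ℓ₂) where

  open Reals ℝ
  open IsStrictPartialOrder isStrictPartialOrder
    using (<-respˡ-≈; <-respʳ-≈) renaming (irrefl to <-irrefl; trans to <-trans)
  open CommutativeRing commutativeRing using (ring; semiring; commutativeSemiring)
  open import Algebra.Properties.Ring ring
  open import Algebra.Properties.Semiring.Mult semiring using (×-homo-+; ×1-homo-*)
  open import Algebra.Apartness.Properties.HeytingCommutativeRing heytingCommutativeRing
    using (x-0≈x; 1#0; #-congʳ; invertibleˡ⇒#)
  open import Relation.Binary.Reasoning.Setoid setoid
  open import Algebra.Solver.Ring.NaturalCoefficients.Default commutativeSemiring
    using (solve; _:+_; _:*_; _:=_)
  open RingSums commutativeRing

  #0⇒inverse : ∀ {x} → x # 0# → ∃[ y ] y * x ≈ 1#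
  #0⇒inverse {x} x#0 with y , yx≈1 , _ ← #⇒invertible x#0 =
    y , trans (*-congˡ (sym (x-0≈x x))) yx≈1

  inverse⇒#0 : ∀ {x y} → y * x ≈ 1# → x # 0#
  inverse⇒#0 {x} {y} yx≈1 = invertibleˡ⇒# (y , trans (*-congˡ (x-0≈x x)) yx≈1)

  #0-cancelˡ : ∀ {x y} → x # 0# → x * y ≈ 0# → y ≈ 0#
  #0-cancelˡ {x} {y} x#0 xy≈0 with x⁻¹ , eq ← #0⇒inverse x#0 = begin
    y             ≈⟨ *-identityˡ y ⟨
    1# * y        ≈⟨ *-congʳ eq ⟨
    x⁻¹ * x * y   ≈⟨ *-assoc x⁻¹ x y ⟩
    x⁻¹ * (x * y) ≈⟨ *-congˡ xy≈0 ⟩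
    x⁻¹ * 0#      ≈⟨ zeroʳ x⁻¹ ⟩
    0#            ∎

  ¬#⇒≈ : ∀ {x y} → ¬ x # y → x ≈ y
  ¬#⇒≈ {x} {y} = proj₁ (tight x y)

  x*x#0⇒x#0 : ∀ {x} → x * x # 0# → x # 0#
  x*x#0⇒x#0 {x} xx#0 with y , eq ← #0⇒inverse xx#0 =
    inverse⇒#0 (trans (*-assoc y x x) eq)

  x<0⇒0<-x : ∀ {x} → x < 0# → 0# < - x
  x<0⇒0<-x {x} x<0 = <-respʳ-≈ (+-identityˡ (- x)) (<-respˡ-≈ (-‿inverseʳ x) (+-monoˡ-< (- x) x<0))

  #0⇒0<x*x : ∀ {x} → x # 0# → 0# < x * x
  #0⇒0<x*x {x} x#0 with #⇒<⊎> x#0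
  ... | inj₂ 0<x = *-pos 0<x 0<x
  ... | inj₁ x<0 = <-respʳ-≈ -x*-x≈x*x (*-pos (x<0⇒0<-x x<0) (x<0⇒0<-x x<0))
    where
    -x*-x≈x*x : - x * - x ≈ x * x
    -x*-x≈x*x = begin
      - x * - x     ≈⟨ -‿distribˡ-* x (- x) ⟨
      - (x * - x)   ≈⟨ -‿cong (-‿distribʳ-* x x) ⟨
      - - (x * x)   ≈⟨ -‿involutive (x * x) ⟩
      x * x         ∎

  0<1 : 0# < 1#
  0<1 = <-respʳ-≈ (*-identityˡ 1#) (#0⇒0<x*x 1#0)

  0<x⇒y<x+y : ∀ {x} y → 0# < x → y < x + y
  0<x⇒y<x+y y 0<x = <-respˡ-≈ (+-identityˡ y) (+-monoˡ-< y 0<x)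

  0<suc·1 : ∀ m → 0# < suc m ·ℕ 1#
  0<suc·1 zero    = <-respʳ-≈ (sym (+-identityʳ 1#)) 0<1
  0<suc·1 (suc m) = <-trans (0<suc·1 m) (0<x⇒y<x+y _ 0<1)

  -- Stated negatively because only a strict order, not assumed decidable, is given. This form still
  -- passes to sums, and it contradicts any strict inequality the other way.
  NonNegative : Carrier → Set ℓ₂
  NonNegative x = ¬ x < 0#

  0-nonNegative : NonNegative 0#
  0-nonNegative = <-irrefl refl

  -- A negative square is apart from 0, hence so is `x`, and then the square is positive. The sign
  -- of an arbitrary `x` is never decided.
  square-nonNegative : ∀ x → NonNegative (x * x)
  square-nonNegative x xx<0 =
    <-irrefl refl (<-trans xx<0 (#0⇒0<x*x (x*x#0⇒x#0 (<⇒# xx<0))))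

  -- Cotransitivity at `y` replaces a sign test: `x + y` apart from 0 gives `x + y # y` or `y # 0`.
  -- Each of the four resulting strict inequalities makes `x` or `y` negative.
  nonNegative-+ : ∀ {x y} → NonNegative x → NonNegative y → NonNegative (x + y)
  nonNegative-+ {x} {y} 0≤x 0≤y x+y<0 with #-cotrans (<⇒# x+y<0) y
  ... | inj₂ y#0 with #⇒<⊎> y#0
  ...   | inj₁ y<0 = 0≤y y<0
  ...   | inj₂ 0<y = 0≤x (<-trans (<-respʳ-≈ (+-comm y x) (0<x⇒y<x+y x 0<y)) x+y<0)
  nonNegative-+ {x} {y} 0≤x 0≤y x+y<0 | inj₁ x+y#y with #⇒<⊎> x+y#y
  ...   | inj₂ y<x+y = 0≤y (<-trans y<x+y x+y<0)
  ...   | inj₁ x+y<y = 0≤x (<-respˡ-≈ x+y-y≈x (<-respʳ-≈ (-‿inverseʳ y) (+-monoˡ-< (- y) x+y<y)))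
    where
    x+y-y≈x : x + y - y ≈ x
    x+y-y≈x = trans (+-assoc x y (- y)) (trans (+-congˡ (-‿inverseʳ y)) (+-identityʳ x))

  positive+nonNegative#0 : ∀ {x y} → 0# < x → NonNegative y → x + y # 0#
  positive+nonNegative#0 {x} {y} 0<x 0≤y with #-cotrans (<⇒# (0<x⇒y<x+y y 0<x)) 0#
  ... | inj₂ 0#x+y = #-sym 0#x+y
  ... | inj₁ y#0 with #⇒<⊎> y#0
  ...   | inj₁ y<0 = contradiction y<0 0≤y
  ...   | inj₂ 0<y = #-sym (<⇒# (<-trans 0<y (0<x⇒y<x+y y 0<x)))

  sumᴸ-nonNegative : ∀ {a} {A : Set a} {h : A → Carrier} → (∀ x → NonNegative (h x)) →
    ∀ xs → NonNegative (sumᴸ h xs)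
  sumᴸ-nonNegative 0≤h []       = 0-nonNegative
  sumᴸ-nonNegative 0≤h (x ∷ xs) = nonNegative-+ (0≤h x) (sumᴸ-nonNegative 0≤h xs)

  -- `x` is the difference `a - b` of two natural numbers, written without subtraction so that
  -- closure reduces to semiring identities. These are the reals for which being zero can be
  -- decided.
  Integral : Carrier → Set ℓ₁
  Integral x = ∃[ a ] ∃[ b ] x + b ·ℕ 1# ≈ a ·ℕ 1#

  integral-resp : ∀ {x y} → x ≈ y → Integral x → Integral y
  integral-resp x≈y (a , b , eq) = a , b , trans (+-congʳ (sym x≈y)) eq

  integral-0 : Integral 0#
  integral-0 = 0 , 0 , +-identityˡ 0#

  integral-1 : Integral 1#
  integral-1 = 1 , 0 , refl

  integral-+ : ∀ {x y} → Integral x → Integral y → Integral (x + y)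
  integral-+ {x} {y} (a , b , x+b≈a) (c , d , y+d≈c) = a ℕ.+ c , b ℕ.+ d , (begin
    x + y + (b ℕ.+ d) ·ℕ 1#               ≈⟨ +-congˡ (×-homo-+ 1# b d) ⟩
    x + y + (b ·ℕ 1# + d ·ℕ 1#)           ≈⟨ solve 4 (λ x y b d → x :+ y :+ (b :+ d) := (x :+ b) :+ (y :+ d))
                                               refl x y _ _ ⟩
    (x + b ·ℕ 1#) + (y + d ·ℕ 1#)         ≈⟨ +-cong x+b≈a y+d≈c ⟩
    a ·ℕ 1# + c ·ℕ 1#                     ≈⟨ ×-homo-+ 1# a c ⟨
    (a ℕ.+ c) ·ℕ 1#                       ∎)

  integral-* : ∀ {x y} → Integral x → Integral y → Integral (x * y)
  integral-* {x} {y} (a , b , x+b≈a) (c , d , y+d≈c) =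
    -- From `(a - b)(c - d) = (ac + bd) - (bc + ad)`.
    a ℕ.* c ℕ.+ b ℕ.* d , b ℕ.* c ℕ.+ a ℕ.* d , (begin
    x * y + (b ℕ.* c ℕ.+ a ℕ.* d) ·ℕ 1#
      ≈⟨ +-congˡ (homo b c a d) ⟩
    x * y + (b′ * c′ + a′ * d′)
      -- Undoing `c′` to `y + d′` and `a′` to `x + b′` in just these two products leaves an identity
      -- without subtraction.
      ≈⟨ +-congˡ (+-cong (*-congˡ y+d≈c) (*-congʳ x+b≈a)) ⟨
    x * y + (b′ * (y + d′) + (x + b′) * d′)
      ≈⟨ solve 4 (λ x y b d → x :* y :+ (b :* (y :+ d) :+ (x :+ b) :* d) :=
           (x :+ b) :* (y :+ d) :+ b :* d) refl x y b′ d′ ⟩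
    (x + b′) * (y + d′) + b′ * d′
      ≈⟨ +-congʳ (*-cong x+b≈a y+d≈c) ⟩
    a′ * c′ + b′ * d′
      ≈⟨ homo a c b d ⟨
    (a ℕ.* c ℕ.+ b ℕ.* d) ·ℕ 1# ∎)
    where
    a′ = a ·ℕ 1#
    b′ = b ·ℕ 1#
    c′ = c ·ℕ 1#
    d′ = d ·ℕ 1#
    homo : ∀ p q r s → (p ℕ.* q ℕ.+ r ℕ.* s) ·ℕ 1# ≈ p ·ℕ 1# * q ·ℕ 1# + r ·ℕ 1# * s ·ℕ 1#
    homo p q r s = trans (×-homo-+ 1# (p ℕ.* q) (r ℕ.* s)) (+-cong (×1-homo-* p q) (×1-homo-* r s))

  integral-neg : ∀ {x} → Integral x → Integral (- x)
  integral-neg {x} (a , b , x+b≈a) = b , a , (begin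
    - x + a ·ℕ 1#         ≈⟨ +-congˡ x+b≈a ⟨
    - x + (x + b ·ℕ 1#)   ≈⟨ +-assoc _ _ _ ⟨
    - x + x + b ·ℕ 1#     ≈⟨ +-congʳ (-‿inverseˡ x) ⟩
    0# + b ·ℕ 1#          ≈⟨ +-identityˡ _ ⟩
    b ·ℕ 1#               ∎)

  integral-sumᴸ : ∀ {a} {A : Set a} {h : A → Carrier} → (∀ x → Integral (h x)) →
    ∀ xs → Integral (sumᴸ h xs)
  integral-sumᴸ int []       = integral-0
  integral-sumᴸ int (x ∷ xs) = integral-+ (int x) (integral-sumᴸ int xs)

  -- The comparison takes place between the natural numbers `a` and `b`. If they differ, then `x` or
  -- `- x` is `suc m ·ℕ 1#`, which is positive.
  integral-≈0⊎#0 : ∀ {x} → Integral x → x ≈ 0# ⊎ x # 0#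
  integral-≈0⊎#0 {x} (a , b , x+b≈a) with ℕ.<-cmp a b
  ... | tri≈ _ ≡.refl _ = inj₁ (+-identityˡ-unique x _ x+b≈a)
  ... | tri> _ _ b<a with m , ≡.refl ← ℕ.m≤n⇒∃[o]m+o≡n b<a = inj₂ $
    #-congʳ (sym x≈suc-m) (#-sym (<⇒# (0<suc·1 m)))
    where
    x≈suc-m : x ≈ suc m ·ℕ 1#
    x≈suc-m = +-cancelʳ (b ·ℕ 1#) x (suc m ·ℕ 1#) $ begin
      x + b ·ℕ 1#                     ≈⟨ x+b≈a ⟩
      suc (b ℕ.+ m) ·ℕ 1#             ≡⟨ ≡.cong (λ k → suc k ·ℕ 1#) (ℕ.+-comm b m) ⟩
      (suc m ℕ.+ b) ·ℕ 1#             ≈⟨ ×-homo-+ 1# (suc m) b ⟩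
      suc m ·ℕ 1# + b ·ℕ 1#           ∎
  ... | tri< a<b _ _ with m , ≡.refl ← ℕ.m≤n⇒∃[o]m+o≡n a<b = inj₂ $
    <⇒# (<-respʳ-≈ x+suc-m≈0 (<-respˡ-≈ (+-identityʳ x)
      (<-respʳ-≈ (+-comm _ x) (<-respˡ-≈ (+-comm 0# x) (+-monoˡ-< x (0<suc·1 m))))))
    where
    x+suc-m≈0 : x + suc m ·ℕ 1# ≈ 0#
    x+suc-m≈0 = +-identityˡ-unique _ (a ·ℕ 1#) $ begin
      x + suc m ·ℕ 1# + a ·ℕ 1#       ≈⟨ +-assoc _ _ _ ⟩
      x + (suc m ·ℕ 1# + a ·ℕ 1#)     ≈⟨ +-congˡ (×-homo-+ 1# (suc m) a) ⟨
      x + (suc m ℕ.+ a) ·ℕ 1#         ≡⟨ ≡.cong (λ k → x + suc k ·ℕ 1#) (ℕ.+-comm m a) ⟩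
      x + suc (a ℕ.+ m) ·ℕ 1#         ≈⟨ x+b≈a ⟩
      a ·ℕ 1#                         ∎

-- Vertices as subsets of fixed size.

∈-subsets : ∀ {n} (S : Subset n) → S ∈ᴸ subsets n
∈-subsets []            = Any.here ≡.refl
∈-subsets (outside ∷ S) = ∈-++⁺ˡ (∈-map⁺ (outside ∷_) (∈-subsets S))
∈-subsets {suc n} (inside ∷ S) =
  ∈-++⁺ʳ (map (outside ∷_) (subsets n)) (∈-map⁺ (inside ∷_) (∈-subsets S))

_≟ⱽ_ : ∀ {n ℓ} (S T : Vertex n ℓ) → Dec (S ≡ T)
(S , _) ≟ⱽ (T , _) with S ≟ˢ T
... | yes ≡.refl = yes ≡.refl
... | no  S≢T    = no λ { ≡.refl → S≢T ≡.refl }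

value-injective : ∀ {n ℓ} {S T : Vertex n ℓ} → value S ≡ value T → S ≡ T
value-injective ≡.refl = ≡.refl

-- The stored size proof is irrelevant and cannot be returned. Deciding the equation anew yields a
-- relevant proof, and the irrelevant one suffices to refute the negative answer.
∣vertex∣ : ∀ {n ℓ} (S : Vertex n ℓ) → ∣ value S ∣ ≡ ℓ
∣vertex∣ {ℓ = ℓ} (S , [ eq ]) with ∣ S ∣ ℕ.≟ ℓ
... | yes eq′ = eq′
... | no  neq = contradiction-irr eq neq

-- Unification recovers the local function of vertices, which has no name in scope.
vertex? : ∀ n ℓ → ∃[ t ] vertices n ℓ ≡ mapMaybe {B = Vertex n ℓ} t (subsets n)
vertex? n ℓ = _ , ≡.refl

module JohnsonProperties {c ℓ₁ ℓ₂} (ℝ : Reals c ℓ₁ ℓ₂) (n ℓ : ℕ) where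

  open Reals ℝ
  open Johnson ℝ n ℓ
  open RealProperties ℝ
  open CommutativeRing commutativeRing using (ring; semiring; commutativeSemiring)
  open import Algebra.Properties.Ring ring
  open import Algebra.Properties.Semiring.Sum semiring
    using (sum-remove; sum-cong-≋; sum-replicate-zero)
  open import Algebra.Apartness.Properties.HeytingCommutativeRing heytingCommutativeRing
    using (x-0≈x; 1#0; x#0y#0→xy#0)
  open import Relation.Binary.Reasoning.Setoid setoid
  open import Algebra.Solver.Ring.NaturalCoefficients.Default commutativeSemiring
    using (solve; _:+_; _:*_; _:=_)
  open RingSums commutativeRing

  -- A sum over vertices is a sum over all subsets in which those of the wrong size contribute 0, so
  -- the statement for `subsets` applies.
  ∑-only : (h : V) (U : Vertex n ℓ) → (∀ T → T ≢ U → h T ≈ 0#) → ∑ h ≈ h U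
  ∑-only h U h≈0 = begin
    sumᴸ h (vertices n ℓ)
      ≈⟨ sumᴸ-mapMaybe h (proj₁ (vertex? n ℓ)) (subsets n) ⟩
    sumᴸ (λ S → maybe′ h 0# (proj₁ (vertex? n ℓ) S)) (subsets n)
      ≈⟨ sumᴸ-subsets-only _ (value U) elsewhere ⟩
    maybe′ h 0# (proj₁ (vertex? n ℓ) (value U))
      ≈⟨ at-U ⟩
    h U ∎
    where
    elsewhere : ∀ S → S ≢ value U → maybe′ h 0# (proj₁ (vertex? n ℓ) S) ≈ 0#
    elsewhere S S≢U with ∣ S ∣ ℕ.≟ ℓ
    ... | yes eq = h≈0 _ λ { ≡.refl → S≢U ≡.refl }
    ... | no  _  = refl
    at-U : maybe′ h 0# (proj₁ (vertex? n ℓ) (value U)) ≈ h U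
    at-U with ∣ value U ∣ ℕ.≟ ℓ
    ... | yes _  = refl
    ... | no neq = contradiction (∣vertex∣ U) neq

  -- The inner product on `V`.

  infixl 6 _-ⱽ_
  _-ⱽ_ : V → V → V
  (f -ⱽ g) S = f S - g S

  ⟨⟩-cong : ∀ {f f′ g g′} → f ≋ f′ → g ≋ g′ → ⟨ f , g ⟩ ≈ ⟨ f′ , g′ ⟩
  ⟨⟩-cong f≋ g≋ = sumᴸ-cong (λ S → *-cong (f≋ S) (g≋ S)) (vertices n ℓ)

  ⟨⟩-congˡ : ∀ f {g g′} → g ≋ g′ → ⟨ f , g ⟩ ≈ ⟨ f , g′ ⟩
  ⟨⟩-congˡ f g≋ = ⟨⟩-cong {f} (λ _ → refl) g≋

  ⟨⟩-congʳ : ∀ g {f f′} → f ≋ f′ → ⟨ f , g ⟩ ≈ ⟨ f′ , g ⟩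
  ⟨⟩-congʳ g f≋ = ⟨⟩-cong {g = g} f≋ (λ _ → refl)

  ⟨⟩-comm : ∀ f g → ⟨ f , g ⟩ ≈ ⟨ g , f ⟩
  ⟨⟩-comm f g = sumᴸ-cong (λ S → *-comm (f S) (g S)) (vertices n ℓ)

  ⟨⟩-+ʳ : ∀ f g h → ⟨ f , g +ⱽ h ⟩ ≈ ⟨ f , g ⟩ + ⟨ f , h ⟩
  ⟨⟩-+ʳ f g h = trans (sumᴸ-cong (λ S → distribˡ (f S) (g S) (h S)) (vertices n ℓ))
    (sumᴸ-+ (λ S → f S * g S) (λ S → f S * h S) (vertices n ℓ))

  ⟨⟩-*ʳ : ∀ a f g → ⟨ f , a *ⱽ g ⟩ ≈ a * ⟨ f , g ⟩
  ⟨⟩-*ʳ a f g = trans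
    (sumᴸ-cong (λ S → solve 3 (λ x a y → x :* (a :* y) := a :* (x :* y)) refl (f S) a (g S)) (vertices n ℓ))
    (sumᴸ-*ˡ a (λ S → f S * g S) (vertices n ℓ))

  ⟨⟩-0ʳ : ∀ f {g} → g ≋ 0ⱽ → ⟨ f , g ⟩ ≈ 0#
  ⟨⟩-0ʳ f g≋0 = sumᴸ-zero (λ S → trans (*-congˡ (g≋0 S)) (zeroʳ (f S))) (vertices n ℓ)

  ⟨⟩-+ˡ : ∀ f g h → ⟨ f +ⱽ g , h ⟩ ≈ ⟨ f , h ⟩ + ⟨ g , h ⟩
  ⟨⟩-+ˡ f g h = trans (⟨⟩-comm (f +ⱽ g) h) (trans (⟨⟩-+ʳ h f g) (+-cong (⟨⟩-comm h f) (⟨⟩-comm h g)))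

  ⟨⟩-*ˡ : ∀ a f g → ⟨ a *ⱽ f , g ⟩ ≈ a * ⟨ f , g ⟩
  ⟨⟩-*ˡ a f g = trans (⟨⟩-comm (a *ⱽ f) g) (trans (⟨⟩-*ʳ a g f) (*-congˡ (⟨⟩-comm g f)))

  -- If f S # 0, split the term f S * f S > 0 off the sum; what remains is nonnegative.
  ⟨⟩-definite : ∀ f → ⟨ f , f ⟩ ≈ 0# → f ≋ 0ⱽ
  ⟨⟩-definite f ff≈0 S = ¬#⇒≈ λ fS#0 →
    #-irrefl (trans (sym split) ff≈0) (positive+nonNegative#0
      (#0⇒0<x*x fS#0) (sumᴸ-nonNegative rest-nonNegative (vertices n ℓ)))
    where
    at-S rest : V
    at-S T = if does (T ≟ⱽ S) then f T * f T else 0#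
    rest T = if does (T ≟ⱽ S) then 0# else f T * f T
    rest-nonNegative : ∀ T → NonNegative (rest T)
    rest-nonNegative T with does (T ≟ⱽ S)
    ... | true  = 0-nonNegative
    ... | false = square-nonNegative (f T)
    sum-split : ∀ T → f T * f T ≈ at-S T + rest T
    sum-split T with does (T ≟ⱽ S)
    ... | true  = sym (+-identityʳ _)
    ... | false = sym (+-identityˡ _)
    at-S-only : ∀ T → T ≢ S → at-S T ≈ 0#
    at-S-only T T≢S = reflexive (cong (if_then f T * f T else 0#) (dec-false (T ≟ⱽ S) T≢S))
    split : ⟨ f , f ⟩ ≈ f S * f S + ∑ rest
    split = begin
      ⟨ f , f ⟩                   ≈⟨ sumᴸ-cong sum-split (vertices n ℓ) ⟩
      ∑ (λ T → at-S T + rest T)   ≈⟨ sumᴸ-+ at-S rest (vertices n ℓ) ⟩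
      ∑ at-S + ∑ rest             ≈⟨ +-congʳ (∑-only at-S S at-S-only) ⟩
      at-S S + ∑ rest             ≡⟨ cong (λ b → (if b then f S * f S else 0#) + ∑ rest)
                                       (dec-true (S ≟ⱽ S) ≡.refl) ⟩
      f S * f S + ∑ rest          ∎

  -- Spans and orthogonal complements.

  -‿as-+ : ∀ f g → f -ⱽ g ≋ f +ⱽ (- 1#) *ⱽ g
  -‿as-+ f g S = +-congˡ (sym (-1*x≈-x (g S)))

  ⊥-+ : ∀ {a} {W : Pred V a} {f g} → f ∈ W ^⊥ → g ∈ W ^⊥ → f +ⱽ g ∈ W ^⊥
  ⊥-+ {f = f} {g} f⊥ g⊥ h h∈W = trans (⟨⟩-+ˡ f g h)
    (trans (+-cong (f⊥ h h∈W) (g⊥ h h∈W)) (+-identityˡ 0#))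

  ⊥-* : ∀ {a} {W : Pred V a} x {f} → f ∈ W ^⊥ → x *ⱽ f ∈ W ^⊥
  ⊥-* x {f} f⊥ h h∈W = trans (⟨⟩-*ˡ x f h) (trans (*-congˡ (f⊥ h h∈W)) (zeroʳ x))

  ⊥-resp : ∀ {a} {W : Pred V a} {f g} → f ≋ g → f ∈ W ^⊥ → g ∈ W ^⊥
  ⊥-resp f≋g f⊥ h h∈W = trans (⟨⟩-congʳ h (λ S → sym (f≋g S))) (f⊥ h h∈W)

  ⊥-sub : ∀ {a} {W : Pred V a} {f g} → f ∈ W ^⊥ → g ∈ W ^⊥ → f -ⱽ g ∈ W ^⊥
  ⊥-sub {W = W} {f} {g} f⊥ g⊥ =
    ⊥-resp {W = W} (λ S → sym (-‿as-+ f g S)) (⊥-+ {W = W} f⊥ (⊥-* {W = W} (- 1#) g⊥))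

  span-sub : ∀ {a} {P : Pred V a} {f g} → f ∈ Span P → g ∈ Span P → f -ⱽ g ∈ Span P
  span-sub {f = f} {g} f∈ g∈ = respˢ (λ S → sym (-‿as-+ f g S)) (addˢ f∈ (scaleˢ (- 1#) g∈))

  span-⊆ : ∀ {a b} {P : Pred V a} {Q : Pred V b} →
    (∀ f → f ∈ P → f ∈ Span Q) → ∀ {f} → f ∈ Span P → f ∈ Span Q
  span-⊆ P⊆Q (generator f∈P)  = P⊆Q _ f∈P
  span-⊆ P⊆Q zeroˢ            = zeroˢ
  span-⊆ P⊆Q (addˢ f∈ g∈)     = addˢ (span-⊆ P⊆Q f∈) (span-⊆ P⊆Q g∈)
  span-⊆ P⊆Q (scaleˢ a f∈)    = scaleˢ a (span-⊆ P⊆Q f∈)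
  span-⊆ P⊆Q (respˢ f≋g f∈)   = respˢ f≋g (span-⊆ P⊆Q f∈)

  ⊥-span : ∀ {a} {P : Pred V a} {f} → f ∈ P ^⊥ → f ∈ Span P ^⊥
  ⊥-span f⊥P g (generator g∈P)    = f⊥P g g∈P
  ⊥-span f⊥P _ zeroˢ              = ⟨⟩-0ʳ _ (λ _ → refl)
  ⊥-span {f = f} f⊥P _ (addˢ {g} {h} g∈ h∈) = trans (⟨⟩-+ʳ f g h)
    (trans (+-cong (⊥-span f⊥P g g∈) (⊥-span f⊥P h h∈)) (+-identityˡ 0#))
  ⊥-span {f = f} f⊥P _ (scaleˢ a {g} g∈) = trans (⟨⟩-*ʳ a f g)
    (trans (*-congˡ (⊥-span f⊥P g g∈)) (zeroʳ a))
  ⊥-span {f = f} f⊥P h (respˢ {g} g≋h g∈) = trans (⟨⟩-congˡ f (λ S → sym (g≋h S))) (⊥-span f⊥P g g∈)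

  span-sumᴸ : ∀ {a b} {A : Set a} {P : Pred V b} {φ : A → V} → (∀ x → φ x ∈ Span P) →
    ∀ xs → (λ S → sumᴸ (λ x → φ x S) xs) ∈ Span P
  span-sumᴸ φ∈ []       = zeroˢ
  span-sumᴸ φ∈ (x ∷ xs) = addˢ (φ∈ x) (span-sumᴸ φ∈ xs)

  -- Orthogonal projections by Gram-Schmidt with cleared denominators.

  Integralⱽ : V → Set ℓ₁
  Integralⱽ f = ∀ S → Integral (f S)

  -- The clause on integral vectors keeps the Gram–Schmidt recursion within
  -- vectors for which being zero is decidable.
  Projection : ∀ {a} → Pred V a → Set _
  Projection W = ∀ f → ∃[ w ] w ∈ W × f -ⱽ w ∈ W ^⊥ ×
    (Integralⱽ f → ∃[ x ] x # 0# × Integralⱽ (x *ⱽ (f -ⱽ w)))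

  OneOf : List V → Pred V _
  OneOf vs f = Any (f ≋_) vs

  projection-[] : Projection (Span (OneOf []))
  projection-[] f = 0ⱽ , zeroˢ , ⊥-span {P = OneOf []} (λ _ ()) ,
    λ int → 1# , 1#0 , λ S → integral-resp
      (sym (trans (*-identityˡ _) (x-0≈x (f S)))) (int S)

  -- One Gram-Schmidt step. The residue of `v` modulo the old span is scaled to an integral vector
  -- `u`, so its squared norm `q` is integral and is either 0 or invertible. In the first case `v`
  -- adds nothing to the span; in the second the component along `u` is removed.
  projection-∷ : ∀ v vs → Integralⱽ v →
    Projection (Span (OneOf vs)) → Projection (Span (OneOf (v ∷ vs)))
  projection-∷ v vs int-v proj with w₀ , w₀∈ , v-w₀⊥ , int₀ ← proj v
                               with c , c#0 , int-u ← int₀ int-v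
    = by-cases (integral-≈0⊎#0 int-q)
    where
    W W′ : Pred V _
    W  = Span (OneOf vs)
    W′ = Span (OneOf (v ∷ vs))
    u : V
    u = c *ⱽ (v -ⱽ w₀)
    q = ⟨ u , u ⟩
    int-q : Integral q
    int-q = integral-sumᴸ (λ S → integral-* (int-u S) (int-u S)) (vertices n ℓ)
    W⊆W′ : ∀ {f} → f ∈ W → f ∈ W′
    W⊆W′ = span-⊆ λ f f∈ → generator (Any.there f∈)
    v∈W′ : v ∈ W′
    v∈W′ = generator (Any.here (λ _ → refl))
    u∈W′ : u ∈ W′
    u∈W′ = scaleˢ c (span-sub v∈W′ (W⊆W′ w₀∈))
    u⊥ : u ∈ W ^⊥
    u⊥ = ⊥-* {W = W} c v-w₀⊥
    ⊥W′ : ∀ {g} → g ∈ W ^⊥ → ⟨ g , v ⟩ ≈ 0# → g ∈ W′ ^⊥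
    ⊥W′ {g} g⊥ gv≈0 = ⊥-span {P = OneOf (v ∷ vs)} λ
      { h (Any.here h≋v) → trans (⟨⟩-congˡ g h≋v) gv≈0
      ; h (Any.there h∈) → g⊥ h (generator h∈) }

    by-cases : q ≈ 0# ⊎ q # 0# → Projection W′
    -- `q ≈ 0#` forces `v ≋ w₀`, so `v` is already in the old span and the old projection of `f`
    -- still serves.
    by-cases (inj₁ q≈0) f with w , w∈ , f-w⊥ , int ← proj f =
      w , W⊆W′ w∈ , ⊥W′ f-w⊥ (f-w⊥ v (respˢ w₀≋v w₀∈)) , int
      where
      w₀≋v : w₀ ≋ v
      w₀≋v S = sym (x∙y⁻¹≈ε⇒x≈y _ _ (#0-cancelˡ c#0 (⟨⟩-definite u q≈0 S)))
    by-cases (inj₂ q#0) f with w , w∈ , g⊥ , int ← proj f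
                          with q⁻¹ , q⁻¹q≈1 ← #0⇒inverse q#0
                          with c⁻¹ , c⁻¹c≈1 ← #0⇒inverse c#0 =
      w′ , addˢ (W⊆W′ w∈) (scaleˢ a u∈W′) , ⊥-resp {W = W′} (λ S → sym (f-w′≋g′ S)) (⊥W′ g′⊥ g′v≈0) ,
      integrality ∘ int
      where
      g w′ g′ : V
      -- The Fourier coefficient of the residue `g` along `u`; as `u` is orthogonal to `W`, removing
      -- it keeps `g` orthogonal to `W`.
      a = ⟨ g , u ⟩ * q⁻¹
      g = f -ⱽ w
      w′ = w +ⱽ a *ⱽ u
      g′ = g +ⱽ (- a) *ⱽ u
      f-w′≋g′ : f -ⱽ w′ ≋ g′
      f-w′≋g′ S = begin
        f S - (w S + a * u S)         ≈⟨ +-congˡ (-‿+-comm (w S) (a * u S)) ⟨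
        f S + (- w S + - (a * u S))   ≈⟨ +-assoc _ _ _ ⟨
        f S - w S + - (a * u S)       ≈⟨ +-congˡ (-‿distribˡ-* a (u S)) ⟩
        f S - w S + - a * u S         ∎
      aq≈gu : a * q ≈ ⟨ g , u ⟩
      aq≈gu = trans (*-assoc _ _ _) (trans (*-congˡ q⁻¹q≈1) (*-identityʳ _))
      g′⊥ : g′ ∈ W ^⊥
      g′⊥ = ⊥-+ {W = W} g⊥ (⊥-* {W = W} (- a) u⊥)
      g′u≈0 : ⟨ g′ , u ⟩ ≈ 0#
      g′u≈0 = begin
        ⟨ g′ , u ⟩                          ≈⟨ ⟨⟩-+ˡ g ((- a) *ⱽ u) u ⟩
        ⟨ g , u ⟩ + ⟨ (- a) *ⱽ u , u ⟩      ≈⟨ +-congˡ (⟨⟩-*ˡ (- a) u u) ⟩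
        ⟨ g , u ⟩ + - a * q                 ≈⟨ +-congˡ (-‿distribˡ-* a q) ⟨
        ⟨ g , u ⟩ + - (a * q)               ≈⟨ +-congˡ (-‿cong aq≈gu) ⟩
        ⟨ g , u ⟩ - ⟨ g , u ⟩               ≈⟨ -‿inverseʳ _ ⟩
        0#                                  ∎
      -- Inverting the scaling turns orthogonality to `u` and to `W` into orthogonality to `v`.
      v≋ : v ≋ c⁻¹ *ⱽ u +ⱽ w₀
      v≋ S = sym $ begin
        c⁻¹ * (c * (v S - w₀ S)) + w₀ S     ≈⟨ +-congʳ (*-assoc _ _ _) ⟨
        c⁻¹ * c * (v S - w₀ S) + w₀ S       ≈⟨ +-congʳ (trans (*-congʳ c⁻¹c≈1) (*-identityˡ _)) ⟩
        v S - w₀ S + w₀ S                   ≈⟨ //-rightDividesˡ (w₀ S) (v S) ⟩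
        v S                                 ∎
      g′v≈0 : ⟨ g′ , v ⟩ ≈ 0#
      g′v≈0 = begin
        ⟨ g′ , v ⟩                          ≈⟨ ⟨⟩-congˡ g′ v≋ ⟩
        ⟨ g′ , c⁻¹ *ⱽ u +ⱽ w₀ ⟩             ≈⟨ ⟨⟩-+ʳ g′ (c⁻¹ *ⱽ u) w₀ ⟩
        ⟨ g′ , c⁻¹ *ⱽ u ⟩ + ⟨ g′ , w₀ ⟩     ≈⟨ +-cong (⟨⟩-*ʳ c⁻¹ g′ u) (g′⊥ w₀ w₀∈) ⟩
        c⁻¹ * ⟨ g′ , u ⟩ + 0#               ≈⟨ +-identityʳ _ ⟩
        c⁻¹ * ⟨ g′ , u ⟩                    ≈⟨ *-congˡ g′u≈0 ⟩
        c⁻¹ * 0#                            ≈⟨ zeroʳ c⁻¹ ⟩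
        0#                                  ∎
      integrality : ∃[ x ] x # 0# × Integralⱽ (x *ⱽ g) →
        ∃[ x ] x # 0# × Integralⱽ (x *ⱽ (f -ⱽ w′))
      integrality (x , x#0 , int-xg) =
        -- `x` clears the denominators of `g`, and `q` is the denominator that `a` introduces.
        q * x , x#0y#0→xy#0 q#0 x#0 , λ S →
          integral-resp (sym (cleared S)) (integral-+
            (integral-* int-q (int-xg S))
            (integral-* (integral-neg (integral-sumᴸ (λ T → integral-* (int-xg T) (int-u T)) (vertices n ℓ)))
              (int-u S)))
        where
        xg,u : ⟨ x *ⱽ g , u ⟩ ≈ x * (a * q)
        xg,u = trans (⟨⟩-*ˡ x g u) (*-congˡ (sym aq≈gu))
        cleared : (q * x) *ⱽ (f -ⱽ w′) ≋ q *ⱽ (x *ⱽ g) +ⱽ (- ⟨ x *ⱽ g , u ⟩) *ⱽ u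
        cleared S = begin
          q * x * (f S - w′ S)
            ≈⟨ *-congˡ (f-w′≋g′ S) ⟩
          q * x * (g S + - a * u S)
            ≈⟨ solve 5 (λ q x g a u → q :* x :* (g :+ a :* u) := q :* (x :* g) :+ x :* (a :* q) :* u)
                 refl q x (g S) (- a) (u S) ⟩
          q * (x * g S) + x * (- a * q) * u S
            ≈⟨ +-congˡ (*-congʳ (trans (*-congˡ (sym (-‿distribˡ-* a q))) (sym (-‿distribʳ-* x (a * q))))) ⟩
          q * (x * g S) + - (x * (a * q)) * u S
            ≈⟨ +-congˡ (*-congʳ (-‿cong xg,u)) ⟨
          q * (x * g S) + - ⟨ x *ⱽ g , u ⟩ * u S ∎

  -- The filtration `F` and its orthogonal projections.

  F-mono : ∀ {d e} → d ℕ.≤ e → ∀ {f} → f ∈ F (+ d) → f ∈ F (+ e)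
  F-mono d≤e = span-⊆ λ { f (R , ∣R∣≤d , f≋pR) → generator (R , ℕ.≤-trans ∣R∣≤d d≤e , f≋pR) }

  -- `F⁻ (suc d)` reduces to `F (+ d)` and `F⁻ 0` to the zero space, so facts about the preceding
  -- level follow by cases on `d`.
  F⁻ : ℕ → Pred V _
  F⁻ d = F (ℤ.pred (+ d))

  F⊆F⁻ : ∀ {d e} → d ℕ.< e → ∀ {f} → f ∈ F (+ d) → f ∈ F⁻ e
  F⊆F⁻ (ℕ.s≤s d≤e) = F-mono d≤e

  F⁻⊆F : ∀ d {f} → f ∈ F⁻ d → f ∈ F (+ d)
  F⁻⊆F zero    (lift f≋0) = respˢ (λ S → sym (f≋0 S)) zeroˢ
  F⁻⊆F (suc d) f∈         = F-mono (ℕ.n≤1+n d) f∈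

  F⁻-sub : ∀ d {f g} → f ∈ F⁻ d → g ∈ F⁻ d → f -ⱽ g ∈ F⁻ d
  F⁻-sub zero    (lift f≋0) (lift g≋0) = lift λ S → trans (+-cong (f≋0 S) (-‿cong (g≋0 S))) (-‿inverseʳ 0#)
  F⁻-sub (suc d) f∈ g∈                 = span-sub f∈ g∈

  p-integral : ∀ R → Integralⱽ (p R)
  p-integral R S with does (R ⊆? value S)
  ... | true  = integral-1
  ... | false = integral-0

  projection-ps : ∀ Rs → Projection (Span (OneOf (map p Rs)))
  projection-ps []       = projection-[]
  projection-ps (R ∷ Rs) = projection-∷ (p R) (map p Rs) (p-integral R) (projection-ps Rs)

  -- `F (+ d)` is spanned by a predicate, whereas Gram-Schmidt consumes a list. Filtering `subsets`
  -- by size gives a list with the same span.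
  projection-F : ∀ d f → ∃[ w ] w ∈ F (+ d) × f -ⱽ w ∈ F (+ d) ^⊥
  projection-F d f = let w , w∈ , f-w⊥ , _ = projection-ps Rs f in
    w , span-⊆ (λ g → generator ∘ to) w∈ , λ g g∈ → f-w⊥ g (span-⊆ (λ h → generator ∘ from) g∈)
    where
    small? = λ R → ∣ R ∣ ℕ.≤? d
    Rs : List (Subset n)
    Rs = filter small? (subsets n)
    to : ∀ {g} → g ∈ OneOf (map p Rs) → ∃[ R ] ∣ R ∣ ℕ.≤ d × g ≋ p R
    to g∈ with R , R∈Rs , g≋pR ← find (Any.map⁻ g∈) =
      R , proj₂ (∈-filter⁻ small? {xs = subsets n} R∈Rs) , g≋pR
    from : ∀ {g} → ∃[ R ] ∣ R ∣ ℕ.≤ d × g ≋ p R → g ∈ OneOf (map p Rs)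
    from (R , ∣R∣≤d , g≋pR) = Any.map⁺ (lose (∈-filter⁺ small? (∈-subsets R) ∣R∣≤d) g≋pR)

  projection-F⁻ : ∀ d f → ∃[ w ] w ∈ F⁻ d × f -ⱽ w ∈ F⁻ d ^⊥
  projection-F⁻ zero    f = 0ⱽ , lift (λ _ → refl) , λ { g (lift g≋0) → ⟨⟩-0ʳ _ g≋0 }
  projection-F⁻ (suc d) f = projection-F d f

  F⁻∩F⁻⊥ : ∀ d {f} → f ∈ F⁻ d → f ∈ F⁻ d ^⊥ → f ≋ 0ⱽ
  F⁻∩F⁻⊥ d {f} f∈ f⊥ = ⟨⟩-definite f (f⊥ f f∈)

  -- The spaces `E i` and decompositions into them.

  E-sub : ∀ i {f g} → f ∈ E i → g ∈ E i → f -ⱽ g ∈ E i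
  E-sub i (f∈ , f⊥) (g∈ , g⊥) = span-sub f∈ g∈ , ⊥-sub {W = F⁻ i} f⊥ g⊥

  -- The vector of smaller index lies in the preceding level of the larger index, to which the other
  -- vector is orthogonal.
  E-orthogonal : ∀ {i j} → i ≢ j → ∀ {f g} → f ∈ E i → g ∈ E j → ⟨ f , g ⟩ ≈ 0#
  E-orthogonal {i} {j} i≢j {f} {g} (f∈ , f⊥) (g∈ , g⊥) with ℕ.<-cmp i j
  ... | tri< i<j _ _ = trans (⟨⟩-comm f g) (g⊥ f (F⊆F⁻ i<j f∈))
  ... | tri≈ _ i≡j _ = contradiction i≡j i≢j
  ... | tri> _ _ j<i = f⊥ g (F⊆F⁻ j<i g∈)

  ⟨⟩-sum : ∀ {m} f (g : Fin m → V) → ⟨ f , (λ S → sum λ j → g j S) ⟩ ≈ sum λ j → ⟨ f , g j ⟩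
  ⟨⟩-sum {zero}  f g = ⟨⟩-0ʳ f (λ _ → refl)
  ⟨⟩-sum {suc m} f g = trans (⟨⟩-+ʳ f (g Fin.zero) _) (+-congˡ (⟨⟩-sum f (g ∘ Fin.suc)))

  sum-only : ∀ {m} (t : Fin m → Carrier) i → (∀ j → j ≢ i → t j ≈ 0#) → sum t ≈ t i
  sum-only {suc m} t i t≈0 = begin
    sum t                               ≈⟨ sum-remove {i = i} t ⟩
    t i + sum (λ j → t (punchIn i j))   ≈⟨ +-congˡ (sum-cong-≋ λ j → t≈0 _ (punchInᵢ≢i i j)) ⟩
    t i + sum {m} (λ _ → 0#)            ≈⟨ +-congˡ (sum-replicate-zero m) ⟩
    t i + 0#                            ≈⟨ +-identityʳ _ ⟩
    t i                                 ∎

  -- Pairing both sums with `e j = g j - h j` leaves only their `j`-th terms, by orthogonality.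
  -- Hence `e j` has equal products with `g j` and `h j`, so it is orthogonal to itself and
  -- vanishes.
  components-unique : ∀ {m lo} {g h : Fin m → V} →
    (∀ j → g j ∈ E (lo ℕ.+ toℕ j)) → (∀ j → h j ∈ E (lo ℕ.+ toℕ j)) →
    (λ S → sum λ j → g j S) ≋ (λ S → sum λ j → h j S) → ∀ j → g j ≋ h j
  components-unique {m} {lo} {g} {h} g∈ h∈ Σg≋Σh j S =
    x∙y⁻¹≈ε⇒x≈y _ _ (⟨⟩-definite (e j) ee≈0 S)
    where
    e : Fin m → V
    e j = g j -ⱽ h j
    e∈ : ∀ j → e j ∈ E (lo ℕ.+ toℕ j)
    e∈ j = E-sub (lo ℕ.+ toℕ j) (g∈ j) (h∈ j)
    pick : (k : Fin m → V) → (∀ i → k i ∈ E (lo ℕ.+ toℕ i)) →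
      ⟨ e j , (λ S → sum λ i → k i S) ⟩ ≈ ⟨ e j , k j ⟩
    pick k k∈ = trans (⟨⟩-sum (e j) k) (sum-only (λ i → ⟨ e j , k i ⟩) j λ i i≢j →
      E-orthogonal (λ eq → i≢j (≡.sym (toℕ-injective (ℕ.+-cancelˡ-≡ lo _ _ eq)))) (e∈ j) (k∈ i))
    ee≈0 : ⟨ e j , e j ⟩ ≈ 0#
    ee≈0 = begin
      ⟨ e j , e j ⟩                           ≈⟨ ⟨⟩-congˡ (e j) (-‿as-+ (g j) (h j)) ⟩
      ⟨ e j , g j +ⱽ (- 1#) *ⱽ h j ⟩          ≈⟨ ⟨⟩-+ʳ (e j) (g j) _ ⟩
      ⟨ e j , g j ⟩ + ⟨ e j , (- 1#) *ⱽ h j ⟩ ≈⟨ +-congˡ (trans (⟨⟩-*ʳ (- 1#) (e j) (h j)) (-1*x≈-x _)) ⟩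
      ⟨ e j , g j ⟩ - ⟨ e j , h j ⟩           ≈⟨ x≈y⇒x∙y⁻¹≈ε (trans (sym (pick g g∈))
                                                   (trans (⟨⟩-congˡ (e j) Σg≋Σh) (pick h h∈))) ⟩
      0#                                      ∎

  telescope : ∀ (w : ℕ → V) lo m S →
    sum {m} (λ j → w (suc (lo ℕ.+ toℕ j)) S - w (lo ℕ.+ toℕ j) S) ≈ w (lo ℕ.+ m) S - w lo S
  telescope w lo zero S rewrite ℕ.+-identityʳ lo = sym (-‿inverseʳ _)
  telescope w lo (suc m) S = begin
    sum {suc m} (step lo)
      ≈⟨ +-cong (reflexive (cong (λ k → w (suc k) S - w k S) (ℕ.+-identityʳ lo)))
          (sum-cong-≋ {m} λ j → reflexive (cong (λ k → w (suc k) S - w k S) (ℕ.+-suc lo (toℕ j)))) ⟩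
    (w (suc lo) S - w lo S) + sum {m} (step (suc lo))
      ≈⟨ +-congˡ (telescope w (suc lo) m S) ⟩
    (w (suc lo) S - w lo S) + (w (suc lo ℕ.+ m) S - w (suc lo) S)
      ≈⟨ solve 4 (λ a b c d → (a :+ b) :+ (c :+ d) := (c :+ (d :+ a)) :+ b) refl _ _ _ _ ⟩
    (w (suc lo ℕ.+ m) S + (- w (suc lo) S + w (suc lo) S)) - w lo S
      ≈⟨ +-congʳ (trans (+-congˡ (-‿inverseˡ _)) (+-identityʳ _)) ⟩
    w (suc lo ℕ.+ m) S - w lo S
      ≡⟨ cong (λ k → w k S - w lo S) (ℕ.+-suc lo m) ⟨
    w (lo ℕ.+ suc m) S - w lo S ∎
    where
    step : ∀ {m} → ℕ → Fin m → Carrier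
    step lo j = w (suc (lo ℕ.+ toℕ j)) S - w (lo ℕ.+ toℕ j) S

  -- The component in E d is the difference of the projections onto F d and F (d − 1).
  decomposition : ∀ {lo hi} → lo ℕ.≤ suc hi → ∀ {h} →
    h ∈ F (+ hi) → h ∈ F⁻ lo ^⊥ → h ∈ ⨁[ lo ⋯ hi ] E
  decomposition {lo} {hi} lo≤1+hi {h} h∈F h⊥ =
    g , (g∈ , h≋Σg) , λ (k∈ , h≋Σk) →
      components-unique {lo = lo} g∈ k∈ (λ S → trans (sym (h≋Σg S)) (h≋Σk S))
    where
    -- Indices are shifted by one: `w d` is the projection onto level `d - 1`. The telescoping sum
    -- then runs from `w lo` to `w (suc hi)`, and `lo = 0` starts at the zero space.
    w : ℕ → V
    w d = proj₁ (projection-F⁻ d h)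
    w∈ : ∀ d → w d ∈ F⁻ d
    w∈ d = proj₁ (proj₂ (projection-F⁻ d h))
    h-w⊥ : ∀ d → h -ⱽ w d ∈ F⁻ d ^⊥
    h-w⊥ d = proj₂ (proj₂ (projection-F⁻ d h))
    m : ℕ
    m = suc hi ℕ.∸ lo
    g : Fin m → V
    g j = w (suc (lo ℕ.+ toℕ j)) -ⱽ w (lo ℕ.+ toℕ j)
    w-step∈E : ∀ d → w (suc d) -ⱽ w d ∈ E d
    w-step∈E d = span-sub (w∈ (suc d)) (F⁻⊆F d (w∈ d)) ,
      ⊥-resp {W = F⁻ d} differ (⊥-sub {W = F⁻ d} (h-w⊥ d) λ u u∈ → h-w⊥ (suc d) u (F⁻⊆F d u∈))
      where
      differ : (h -ⱽ w d) -ⱽ (h -ⱽ w (suc d)) ≋ w (suc d) -ⱽ w d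
      differ S = begin
        (h S - w d S) - (h S - w (suc d) S)   ≈⟨ +-congˡ (⁻¹-anti-homo‿- (h S) (w (suc d) S)) ⟩
        (h S - w d S) + (w (suc d) S - h S)
          ≈⟨ solve 4 (λ a b c d → (a :+ b) :+ (c :+ d) := (c :+ b) :+ (a :+ d)) refl _ _ _ _ ⟩
        (w (suc d) S - w d S) + (h S - h S)   ≈⟨ +-congˡ (-‿inverseʳ (h S)) ⟩
        (w (suc d) S - w d S) + 0#            ≈⟨ +-identityʳ _ ⟩
        w (suc d) S - w d S                   ∎
    g∈ : ∀ j → g j ∈ E (lo ℕ.+ toℕ j)
    g∈ j = w-step∈E (lo ℕ.+ toℕ j)
    -- `w lo = h - (h - w lo)` is orthogonal to `F⁻ lo` since both terms are, and it also lies in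
    -- `F⁻ lo`.
    w-lo≋0 : w lo ≋ 0ⱽ
    w-lo≋0 = F⁻∩F⁻⊥ lo (w∈ lo) (⊥-resp {W = F⁻ lo}
      (λ S → trans (+-congˡ (⁻¹-anti-homo‿- (h S) (w lo S)))
        (trans (+-comm _ _) (//-rightDividesˡ (h S) (w lo S))))
      (⊥-sub {W = F⁻ lo} h⊥ (h-w⊥ lo)))
    -- Dually, `h` lies in `F (+ hi)`, so its residue there lies in that space and is orthogonal to
    -- it.
    w-top≋h : ∀ S → w (suc hi) S ≈ h S
    w-top≋h S = sym (x∙y⁻¹≈ε⇒x≈y _ _ (F⁻∩F⁻⊥ (suc hi) (F⁻-sub (suc hi) h∈F (w∈ (suc hi))) (h-w⊥ (suc hi)) S))
    h≋Σg : h ≋ (λ S → sum λ j → g j S)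
    h≋Σg S = sym $ begin
      sum (λ j → g j S)             ≈⟨ telescope w lo m S ⟩
      w (lo ℕ.+ m) S - w lo S       ≡⟨ cong (λ k → w k S - w lo S) (ℕ.m+[n∸m]≡n lo≤1+hi) ⟩
      w (suc hi) S - w lo S         ≈⟨ +-cong (w-top≋h S) (-‿cong (w-lo≋0 S)) ⟩
      h S - 0#                      ≈⟨ x-0≈x (h S) ⟩
      h S                           ∎

  -- Functions of bounded degree.

  -- On sets of size `ℓ`, `p` of a vertex is the indicator of that vertex alone, because inclusion
  -- between sets of equal size is equality. This accounts for the upper cutoff at `ℓ`.
  V⊆Fℓ : ∀ f → f ∈ F (+ ℓ)
  V⊆Fℓ f = respˢ eq (span-sumᴸ {φ = λ T → f T *ⱽ p (value T)} (λ T →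
    scaleˢ (f T) (generator (value T , ℕ.≤-reflexive (∣vertex∣ T) , λ _ → refl))) (vertices n ℓ))
    where
    eq : (λ S → ∑ λ T → f T * p (value T) S) ≋ f
    eq S = begin
      ∑ (λ T → f T * p (value T) S)   ≈⟨ ∑-only _ S (λ T T≢S → trans (*-congˡ (reflexive (cong 𝟙
                                           (dec-false (value T ⊆? value S) λ T⊆S → T≢S (value-injective
                                             (⊆∧∣∣≡⇒≡ _ _ T⊆S (≡.trans (∣vertex∣ T) (≡.sym (∣vertex∣ S)))))))))
                                           (zeroʳ (f T))) ⟩
      f S * p (value S) S             ≡⟨ cong (λ b → f S * 𝟙 b) (dec-true (value S ⊆? value S) ⊆-refl) ⟩
      f S * 1#                        ≈⟨ *-identityʳ (f S) ⟩
      f S                             ∎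

  -- In the Möbius expansion at `value S ∩ B`, a term with `R ⊆ B` is a multiple of `p R`, and all
  -- other terms vanish.
  junta∈F : ∀ {d} (B : Subset n) → ∣ B ∣ ℕ.≤ d → (G : Subset n → Carrier) →
    (λ S → G (value S ∩ B)) ∈ F (+ d)
  junta∈F {d} B ∣B∣≤d G = respˢ (λ S → sym (möbius-expansion G (value S ∩ B)))
    (span-sumᴸ {φ = term} term∈ (subsets n))
    where
    term : Subset n → V
    term R S = möbius G R * 𝟙 (does (R ⊆? (value S ∩ B)))
    term∈ : ∀ R → term R ∈ F (+ d)
    term∈ R with R ⊆? B
    ... | yes R⊆B = respˢ (λ S → reflexive (cong (λ b → möbius G R * 𝟙 b) (⊆?-∩ R⊆B (value S))))
      (scaleˢ (möbius G R) (generator (R , ℕ.≤-trans (p⊆q⇒∣p∣≤∣q∣ R⊆B) ∣B∣≤d , λ _ → refl)))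
    ... | no  R⊈B = respˢ (λ S → sym (trans (*-congˡ (reflexive (cong 𝟙
      (dec-false (R ⊆? (value S ∩ B)) λ R⊆ → R⊈B (⊆-trans R⊆ (p∩q⊆q (value S) B)))))) (zeroʳ _))) zeroˢ

  -- Matrices acting on `V`.

  *ᵛ-resp : ∀ M {f g} → f ≋ g → M *ᵛ f ≋ M *ᵛ g
  *ᵛ-resp M f≋g S = sumᴸ-cong (λ T → *-congˡ (f≋g T)) (vertices n ℓ)

  *ᵛ-span : ∀ M {a b} {P : Pred V a} {Q : Pred V b} →
    (∀ f → f ∈ P → M *ᵛ f ∈ Span Q) → ∀ {f} → f ∈ Span P → M *ᵛ f ∈ Span Q
  *ᵛ-span M MP⊆Q (generator f∈P) = MP⊆Q _ f∈P
  *ᵛ-span M MP⊆Q zeroˢ = respˢ (λ S → sym (sumᴸ-zero (λ T → zeroʳ (M S T)) (vertices n ℓ))) zeroˢ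
  *ᵛ-span M MP⊆Q (addˢ {f} {g} f∈ g∈) = respˢ
    (λ S → sym (trans (sumᴸ-cong (λ T → distribˡ (M S T) (f T) (g T)) (vertices n ℓ))
      (sumᴸ-+ (λ T → M S T * f T) (λ T → M S T * g T) (vertices n ℓ))))
    (addˢ (*ᵛ-span M MP⊆Q f∈) (*ᵛ-span M MP⊆Q g∈))
  *ᵛ-span M MP⊆Q (scaleˢ a {f} f∈) = respˢ
    (λ S → sym (trans (sumᴸ-cong (λ T → solve 3 (λ x a y → x :* (a :* y) := a :* (x :* y)) refl
        (M S T) a (f T)) (vertices n ℓ))
      (sumᴸ-*ˡ a (λ T → M S T * f T) (vertices n ℓ))))
    (scaleˢ a (*ᵛ-span M MP⊆Q f∈))
  *ᵛ-span M MP⊆Q (respˢ f≋g f∈) = respˢ (*ᵛ-resp M f≋g) (*ᵛ-span M MP⊆Q f∈)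

  *ᵛ-adjoint : ∀ M → (∀ S T → M S T ≈ M T S) → ∀ f g → ⟨ M *ᵛ f , g ⟩ ≈ ⟨ f , M *ᵛ g ⟩
  *ᵛ-adjoint M M-sym f g = begin
    ∑ (λ S → ∑ (λ T → M S T * f T) * g S)
      ≈⟨ sumᴸ-cong (λ S → sumᴸ-*ʳ (g S) (λ T → M S T * f T) (vertices n ℓ)) (vertices n ℓ) ⟨
    ∑ (λ S → ∑ λ T → M S T * f T * g S)
      ≈⟨ sumᴸ-swap (λ S T → M S T * f T * g S) (vertices n ℓ) (vertices n ℓ) ⟩
    ∑ (λ T → ∑ λ S → M S T * f T * g S)
      ≈⟨ sumᴸ-cong (λ T → trans (sumᴸ-cong (λ S → move S T) (vertices n ℓ))
           (sumᴸ-*ˡ (f T) (λ S → M T S * g S) (vertices n ℓ))) (vertices n ℓ) ⟩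
    ∑ (λ T → f T * ∑ λ S → M T S * g S) ∎
    where
    move : ∀ S T → M S T * f T * g S ≈ f T * (M T S * g S)
    move S T = trans (*-congʳ (*-congʳ (M-sym S T)))
      (solve 3 (λ m f g → m :* f :* g := f :* (m :* g)) refl (M T S) (f T) (g S))

  -- The Laplacian of a single hyperedge.

  module _ (C : Subset n) where

    private
      adjacent? = kikuchiAdjacent? C

    -- Since `S △_` is an involution, `S △ C` is the only possible neighbour of `S`: the Kikuchi
    -- graph of one hyperedge has degrees at most 1.
    adjacent⇒≡ : ∀ {S T} → KikuchiAdjacent C S T → value T ≡ value S △ C
    adjacent⇒≡ {S} {T} eq = ≡.trans (≡.sym (△-cancelˡ (value S) (value T))) (cong (value S △_) eq)

    adjacent-sym : ∀ S T → KikuchiAdjacent C S T → KikuchiAdjacent C T S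
    adjacent-sym S T = ≡.trans (△-comm (value T) (value S))

    L-sym : ∀ S T → L C S T ≈ L C T S
    L-sym S T = +-cong D-sym (-‿cong (reflexive (cong 𝟙
      (does-cong (adjacent? S T) (adjacent? T S) (adjacent-sym S T) (adjacent-sym T S)))))
      where
      D-sym : D C S T ≈ D C T S
      D-sym with S ≟ⱽ T
      ... | yes ≡.refl = refl
      ... | no S≢T = reflexive (≡.trans
        (cong (if_then degree C S ·ℕ 1# else 0#) (dec-false (value S ≟ˢ value T) (S≢T ∘ value-injective)))
        (cong (if_then degree C T ·ℕ 1# else 0#) (≡.sym
          (dec-false (value T ≟ˢ value S) (S≢T ∘ value-injective ∘ ≡.sym)))))

    length-filter-sumᴸ : ∀ S Ts → length (filter (adjacent? S) Ts) ·ℕ 1# ≈ sumᴸ (K C S) Ts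
    length-filter-sumᴸ S []       = refl
    length-filter-sumᴸ S (T ∷ Ts) with does (adjacent? S T)
    ... | true  = +-congˡ (length-filter-sumᴸ S Ts)
    ... | false = trans (length-filter-sumᴸ S Ts) (sym (+-identityˡ _))

    -- Expressing the degree as a row sum of `K` reduces the evaluation of `L` to locating the at
    -- most one nonzero entry in a row of `K`.
    L-row : ∀ f S → (L C *ᵛ f) S ≈ ∑ (K C S) * f S - (K C *ᵛ f) S
    L-row f S = begin
      ∑ (λ T → (D C S T - K C S T) * f T)
        ≈⟨ sumᴸ-cong (λ T → trans ([y-z]x≈yx-zx (f T) (D C S T) (K C S T)) (+-congˡ (sym (-1*x≈-x _)))) (vertices n ℓ) ⟩
      ∑ (λ T → D C S T * f T + - 1# * (K C S T * f T))
        ≈⟨ sumᴸ-+ (λ T → D C S T * f T) (λ T → - 1# * (K C S T * f T)) (vertices n ℓ) ⟩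
      ∑ (λ T → D C S T * f T) + ∑ (λ T → - 1# * (K C S T * f T))
        ≈⟨ +-cong D-row (trans (sumᴸ-*ˡ (- 1#) (λ T → K C S T * f T) (vertices n ℓ)) (-1*x≈-x _)) ⟩
      ∑ (K C S) * f S - (K C *ᵛ f) S ∎
      where
      D-row : ∑ (λ T → D C S T * f T) ≈ ∑ (K C S) * f S
      D-row = begin
        ∑ (λ T → D C S T * f T)
          ≈⟨ ∑-only _ S (λ T T≢S → trans (*-congʳ (reflexive (cong (if_then degree C S ·ℕ 1# else 0#)
               (dec-false (value S ≟ˢ value T) (T≢S ∘ value-injective ∘ ≡.sym))))) (zeroˡ (f T))) ⟩
        D C S S * f S
          ≡⟨ cong (λ b → (if b then degree C S ·ℕ 1# else 0#) * f S) (dec-true (value S ≟ˢ value S) ≡.refl) ⟩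
        degree C S ·ℕ 1# * f S
          ≈⟨ *-congʳ (length-filter-sumᴸ S (vertices n ℓ)) ⟩
        ∑ (K C S) * f S ∎

    -- A neighbour of `S` would have to be `S △ C`, which has the wrong size, so the whole row of
    -- `K` is zero.
    L-isolated : ∀ f S → ∣ value S △ C ∣ ≢ ℓ → (L C *ᵛ f) S ≈ 0#
    L-isolated f S neq = begin
      (L C *ᵛ f) S                     ≈⟨ L-row f S ⟩
      ∑ (K C S) * f S - (K C *ᵛ f) S   ≈⟨ +-cong (*-congʳ (sumᴸ-zero K≈0 (vertices n ℓ)))
                                            (-‿cong (sumᴸ-zero (λ T → trans (*-congʳ (K≈0 T)) (zeroˡ _)) (vertices n ℓ))) ⟩
      0# * f S - 0#                    ≈⟨ trans (x-0≈x _) (zeroˡ _) ⟩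
      0#                               ∎
      where
      K≈0 : ∀ T → K C S T ≈ 0#
      K≈0 T = reflexive (cong 𝟙 (dec-false (adjacent? S T) λ adj →
        neq (≡.trans (cong ∣_∣ (≡.sym (adjacent⇒≡ {S} {T} adj))) (∣vertex∣ T))))

    L-edge : ∀ f S U → value U ≡ value S △ C → (L C *ᵛ f) S ≈ f S - f U
    L-edge f S U U≡S△C = begin
      (L C *ᵛ f) S                     ≈⟨ L-row f S ⟩
      ∑ (K C S) * f S - (K C *ᵛ f) S   ≈⟨ +-cong (*-congʳ (trans (∑-only (K C S) U K≈0) K≈1))
                                            (-‿cong (∑-only (λ T → K C S T * f T) U
                                              λ T T≢U → trans (*-congʳ (K≈0 T T≢U)) (zeroˡ _))) ⟩
      1# * f S - K C S U * f U         ≈⟨ +-cong (*-identityˡ _) (-‿cong (trans (*-congʳ K≈1) (*-identityˡ _))) ⟩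
      f S - f U                        ∎
      where
      K≈0 : ∀ T → T ≢ U → K C S T ≈ 0#
      K≈0 T T≢U = reflexive (cong 𝟙 (dec-false (adjacent? S T) λ adj →
        T≢U (value-injective (≡.trans (adjacent⇒≡ {S} {T} adj) (≡.sym U≡S△C)))))
      K≈1 : K C S U ≈ 1#
      K≈1 = reflexive (cong 𝟙 (dec-true (adjacent? S U)
        (≡.trans (cong (value S △_) U≡S△C) (△-cancelˡ (value S) C))))

    -- Extending L_C p_R to all subsets makes the Möbius expansion applicable.
    Lp : Subset n → Subset n → Carrier
    Lp R Q = if does (∣ Q △ C ∣ ℕ.≟ ∣ Q ∣) then 𝟙 (does (R ⊆? Q)) - 𝟙 (does (R ⊆? (Q △ C))) else 0#

    L-p : ∀ R S → (L C *ᵛ p R) S ≈ Lp R (value S)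
    L-p R S = by-cases same-size?
      where
      same-size? = ∣ value S △ C ∣ ℕ.≟ ∣ value S ∣
      edge-value = 𝟙 (does (R ⊆? value S)) - 𝟙 (does (R ⊆? (value S △ C)))
      by-cases : Dec (∣ value S △ C ∣ ≡ ∣ value S ∣) → (L C *ᵛ p R) S ≈ Lp R (value S)
      by-cases (yes eq) = trans (L-edge (p R) S (value S △ C , [ ≡.trans eq (∣vertex∣ S) ]) ≡.refl)
        (reflexive (≡.sym (cong (if_then edge-value else 0#) (dec-true same-size? eq))))
      by-cases (no neq) = trans (L-isolated (p R) S λ eq → neq (≡.trans eq (≡.sym (∣vertex∣ S))))
        (reflexive (≡.sym (cong (if_then edge-value else 0#) (dec-false same-size? neq))))

    -- The size test amounts to `∣ Q ∩ C ∣` being half of `∣ C ∣`, and `Q` and `Q ∩ (R ∪ C)` meet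
    -- `C` in the same set. The two inclusion tests see only points of `R`.
    Lp-local : ∀ R Q → Lp R Q ≡ Lp R (Q ∩ (R ∪ C))
    Lp-local R Q = cong₂ (if_then_else 0#)
        (does-cong (∣ Q △ C ∣ ℕ.≟ ∣ Q ∣) (∣ Q′ △ C ∣ ℕ.≟ ∣ Q′ ∣)
          (⇒∣S△C∣≡∣S∣ Q′ C ∘ subst Balanced (≡.sym (∩-restrict Q R C)) ∘ ∣S△C∣≡∣S∣⇒ Q C)
          (⇒∣S△C∣≡∣S∣ Q C ∘ subst Balanced (∩-restrict Q R C) ∘ ∣S△C∣≡∣S∣⇒ Q′ C))
        (cong₂ (λ a b → 𝟙 a - 𝟙 b) (⊆?-∩ R⊆B Q) (⊆?-△ R⊆B Q C))
      where
      Q′ = Q ∩ (R ∪ C)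
      R⊆B : R ⊆ R ∪ C
      R⊆B = p⊆p∪q C
      Balanced : Subset n → Set
      Balanced T = ∣ T ∣ ℕ.+ ∣ T ∣ ≡ ∣ C ∣

    L-F : ∀ {d f} → f ∈ F (+ d) → L C *ᵛ f ∈ F (+ (d ℕ.+ ∣ C ∣))
    L-F {d} = *ᵛ-span (L C) λ { f (R , ∣R∣≤d , f≋pR) →
      respˢ (λ S → sym (trans (*ᵛ-resp (L C) f≋pR S) (trans (L-p R S) (reflexive (Lp-local R (value S))))))
        (junta∈F (R ∪ C) (ℕ.≤-trans (∣p∪q∣≤∣p∣+∣q∣ R C) (ℕ.+-monoˡ-≤ ∣ C ∣ ∣R∣≤d)) (Lp R)) }

    L-F⁻⊥ : ∀ i {f} → f ∈ F⁻ i ^⊥ → L C *ᵛ f ∈ F⁻ (i ℕ.∸ ∣ C ∣) ^⊥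
    L-F⁻⊥ i {f} f⊥ g g∈ with i ℕ.∸ ∣ C ∣ in eq
    -- Truncated subtraction gives 0 when `i ≤ ∣ C ∣`; then the target is the complement of the zero
    -- space.
    ... | zero  = ⟨⟩-0ʳ (L C *ᵛ f) (lower g∈)
    -- Here `g` has degree at most `d = i - ∣ C ∣ - 1`. Moving `L C` to `g` raises this to at most
    -- `i - 1`, where `f` is orthogonal.
    ... | suc d = trans (*ᵛ-adjoint (L C) L-sym f g) (f⊥ (L C *ᵛ g) (F⊆F⁻ d+∣C∣<i (L-F g∈)))
      where
      d+∣C∣<i : d ℕ.+ ∣ C ∣ ℕ.< i
      d+∣C∣<i = ℕ.m≤o∸n⇒m+n≤o (suc d)
        (ℕ.<⇒≤ (ℕ.m∸n≢0⇒n<m λ i∸∣C∣≡0 → case ≡.trans (≡.sym eq) i∸∣C∣≡0 of λ ()))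
        (ℕ.≤-reflexive (≡.sym eq))

open import Data.Nat.Base using (_≤_; _*_; _+_; _∸_; _⊔_; _⊓_)

corollary4p7 : ∀ {c ℓ₁ ℓ₂} (ℝ : Reals c ℓ₁ ℓ₂) (r k n ℓ : ℕ) →
    1 ≤ r → k ≡ 2 * r → 2 * ℓ ≤ n →
    (C : Subset n) → ∣ C ∣ ≡ k →
    let open Johnson ℝ n ℓ in
    ∀ i → i ≤ ℓ → ∀ f → f ∈ E i →
    L C *ᵛ f ∈ ⨁[ 0 ⊔ (i ∸ k) ⋯ ℓ ⊓ (i + k) ] E
corollary4p7 ℝ r k n ℓ _ _ _ C ≡.refl i i≤ℓ f (f∈F , f⊥) =
  decomposition lo≤1+hi Lf∈F (L-F⁻⊥ C i f⊥)
  where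
  open Johnson ℝ n ℓ
  open JohnsonProperties ℝ n ℓ
  -- Guarantees that the `suc hi ∸ lo` components starting at `lo` really end at `hi`; `0 ⊔ (i ∸ k)`
  -- reduces to `i ∸ k`.
  lo≤1+hi : i ∸ k ≤ suc (ℓ ⊓ (i + k))
  lo≤1+hi = ℕ.m≤n⇒m≤1+n (ℕ.⊓-glb (ℕ.≤-trans (ℕ.m∸n≤m i k) i≤ℓ)
    (ℕ.≤-trans (ℕ.m∸n≤m i k) (ℕ.m≤m+n i k)))
  -- If the minimum is `ℓ`, every function qualifies; otherwise the bound comes from the degree
  -- increase under `L C`.
  Lf∈F : L C *ᵛ f ∈ F (+ (ℓ ⊓ (i + k)))
  Lf∈F with ℕ.⊓-sel ℓ (i + k)
  ... | inj₁ eq = subst (λ d → L C *ᵛ f ∈ F (+ d)) (≡.sym eq) (V⊆Fℓ (L C *ᵛ f))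
  ... | inj₂ eq = subst (λ d → L C *ᵛ f ∈ F (+ d)) (≡.sym eq) (L-F C f∈F)
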